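{- For all integers $n\geq 0$ and each $r\in\{22, 36, 50, 64, 78, 92\}$, we have \[ \mathcal{EO}_u(98n+r)\equiv 0 \pmod{64}. \]
   Context: For a positive integer $k$, let $f_k:=(q^k;q^k)_\infty=\prod_{i=1}^\infty(1-q^{ki})$. The integers $\mathcal{EO}_u(n)$, $n\ge 0$, are defined by $\sum_{n=0}^\infty \mathcal{EO}_u(n)q^n=\dfrac{f_4^2}{f_2^2}$. -}

module Defs where

open import Data.Bool.Base using (if_then_else_)
open import Data.Fin.Base using (Fin; zero; suc; toℕ)
open import Data.Fin.Properties using (toℕ<n)
open import Data.Integer.Base using (ℤ; 0ℤ; 1ℤ; _+_; _-_; _*_)
open import Data.Integer.Properties
  using (+-0-commutativeMonoid; +-identityʳ; +-assoc; +-inverseˡ; *-identityˡ; *-zeroˡ)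
open import Data.Nat.Base as ℕ using (ℕ; zero; suc; NonZero; _∸_; _≡ᵇ_; z≤n; s≤s)
import Data.Nat.Properties as ℕ
open import Data.Vec.Functional using (Vector; _∷_; [])
open import Relation.Binary.PropositionalEquality
open import Algebra.Properties.CommutativeMonoid.Sum +-0-commutativeMonoid
  using (sum; sum⁺-syntax; sum-syntax; sum-cong-≗; sum-replicate-zero)

-- Formal power series in q over ℤ, as coefficient sequences.
Series : Set
Series = ℕ → ℤ

infixl 7 _⋆_ _÷_
infix  8 _²

_⋆_ : Series → Series → Series
(f ⋆ g) n = ∑[ i ≤ n ] (f (toℕ i) * g (n ∸ toℕ i))

_² : Series → Series
f ² = f ⋆ f

q^_ : ℕ → Series
(q^ m) n = if n ≡ᵇ m then 1ℤ else 0ℤ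

-- (1 - q^k)(1 - q^{2k}) ⋯ (1 - q^{Nk})
partialProduct : ℕ → ℕ → Series
partialProduct k zero    = q^ 0
partialProduct k (suc N) = (λ n → (q^ 0) n - (q^ (k ℕ.* suc N)) n) ⋆ partialProduct k N

-- The infinite product (q^k; q^k)_∞ is the coefficientwise limit of its partial
-- products: since k ≥ 1, the coefficient of q^n no longer changes from the n-th
-- partial product on (see `partialProduct-stable`).
f[_] : (k : ℕ) → .{{NonZero k}} → Series
f[ k ] n = partialProduct k n n

-- Long division of g by a series f with constant term 1: the coefficients of
-- h = g / f satisfy h(n) = g(n) - Σ_{i<n} f(i+1) h(n-1-i).  `quotients g f n` is
-- the vector h(n-1), …, h(0).  For other f the value is meaningless.
quotients : Series → Series → ∀ n → Vector ℤ n
quotientStep : Series → Series → Series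

quotientStep g f n = g n - ∑[ i < n ] (f (suc (toℕ i)) * quotients g f n i)

quotients g f zero    = []
quotients g f (suc n) = quotientStep g f n ∷ quotients g f n

_÷_ : Series → Series → Series
_÷_ = quotientStep

EOᵤ : Series
EOᵤ = f[ 4 ] ² ÷ f[ 2 ] ²

private
  ≡ᵇ-< : ∀ {m n} → m ℕ.< n → (q^ n) m ≡ 0ℤ
  ≡ᵇ-< {zero}  {suc n} _         = refl
  ≡ᵇ-< {suc m} {suc n} (s≤s m<n) = ≡ᵇ-< m<n

  sum-zero : ∀ {n} (t : Vector ℤ n) → (∀ i → t i ≡ 0ℤ) → sum t ≡ 0ℤ
  sum-zero {n} t t≡0 = trans (sum-cong-≗ t≡0) (sum-replicate-zero n)

  factor-⋆ : ∀ m (g : Series) n → n ℕ.< m →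
             ((λ j → (q^ 0) j - (q^ m) j) ⋆ g) n ≡ g n
  factor-⋆ m g n n<m = begin
    (1ℤ - (q^ m) 0) * g n + sum rest
      ≡⟨ cong₂ (λ a b → (1ℤ - a) * g n + b)
           (≡ᵇ-< (ℕ.≤-<-trans z≤n n<m)) (sum-zero rest rest≡0) ⟩
    1ℤ * g n + 0ℤ
      ≡⟨ +-identityʳ _ ⟩
    1ℤ * g n
      ≡⟨ *-identityˡ (g n) ⟩
    g n ∎
    where
    open ≡-Reasoning
    rest : Vector ℤ n
    rest i = (0ℤ - (q^ m) (suc (toℕ i))) * g (n ∸ suc (toℕ i))
    rest≡0 : ∀ i → rest i ≡ 0ℤ
    rest≡0 i = trans
      (cong (λ a → (0ℤ - a) * g (n ∸ suc (toℕ i))) (≡ᵇ-< (ℕ.≤-<-trans (toℕ<n i) n<m)))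
      (*-zeroˡ (g (n ∸ suc (toℕ i))))

  partialProduct-stable′ : ∀ k .{{_ : NonZero k}} n d →
                           partialProduct k (d ℕ.+ n) n ≡ f[ k ] n
  partialProduct-stable′ k n zero    = refl
  partialProduct-stable′ k n (suc d) = trans
    (factor-⋆ (k ℕ.* suc (d ℕ.+ n)) (partialProduct k (d ℕ.+ n)) n
      (ℕ.≤-trans (s≤s (ℕ.m≤n+m n d)) (ℕ.m≤n*m (suc (d ℕ.+ n)) k)))
    (partialProduct-stable′ k n d)

  quotients-lookup : ∀ g f n (i : Fin n) → quotients g f n i ≡ (g ÷ f) (n ∸ suc (toℕ i))
  quotients-lookup g f (suc n) zero    = refl
  quotients-lookup g f (suc n) (suc i) = quotients-lookup g f n i

partialProduct-stable : ∀ k .{{_ : NonZero k}} {n N} → n ℕ.≤ N →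
                        partialProduct k N n ≡ f[ k ] n
partialProduct-stable k {n} {N} n≤N =
  subst (λ M → partialProduct k M n ≡ f[ k ] n) (ℕ.m∸n+n≡m n≤N)
    (partialProduct-stable′ k n (N ∸ n))

⋆-÷ : ∀ g f → f 0 ≡ 1ℤ → f ⋆ (g ÷ f) ≗ g
⋆-÷ g f f0≡1 n = begin
  f 0 * (g ÷ f) n + ∑[ i < n ] (f (suc (toℕ i)) * (g ÷ f) (n ∸ suc (toℕ i)))
    ≡⟨ cong₂ _+_ (trans (cong (_* (g ÷ f) n) f0≡1) (*-identityˡ ((g ÷ f) n)))
         (sum-cong-≗ λ i → cong (f (suc (toℕ i)) *_) (sym (quotients-lookup g f n i))) ⟩
  g n - s + s
    ≡⟨ trans (+-assoc (g n) _ s) (cong (g n +_) (+-inverseˡ s)) ⟩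
  g n + 0ℤ
    ≡⟨ +-identityʳ (g n) ⟩
  g n ∎
  where
  open ≡-Reasoning
  s : ℤ
  s = ∑[ i < n ] (f (suc (toℕ i)) * quotients g f n i)

EOᵤ-spec : f[ 2 ] ² ⋆ EOᵤ ≗ f[ 4 ] ²
EOᵤ-spec = ⋆-÷ (f[ 4 ] ²) (f[ 2 ] ²) refl

{-# OPTIONS --safe #-}
module Submission where

-- Put a = f₂, b = f₄² and E = f₄²/f₂².  With the theta series g = Σ (-1)^l q^{2l²} = f₂²/f₄ and
-- ρ = Σ (6j+1) q^{j(3j+1)} = f₂⁵/f₄² one has a² = E g², a ρ = E g⁴ and ρ² = E g⁶.  Since g = 1 + 2u,
-- (1 - g²)³ is divisible by 64, so E ≡ 3a² - 3aρ + ρ² (mod 64).  By Euler's pentagonal number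
-- theorem a, like ρ, is supported on exponents e such that 12e + 1 is a square, so a coefficient
-- of q^n on the right is nonzero only if 12n + 2 = x² + y².  For n = 98k + r the number 12n + 2
-- is divisible by 7 but not by 49, which is impossible for a sum of two squares.
-- The series for f₂ and f₄, for g and for f₂³ come from a finite form of Jacobi's triple product,
-- and the formula for ρ from multiplying the series of f₂³ and g.

open import Defs
open import Algebra.Bundles using (CommutativeRing)
open import Algebra.Solver.Ring.AlmostCommutativeRing
  using (fromCommutativeRing; _-Raw-AlmostCommutative⟶_)
open import Data.Fin.Base as Fin using (Fin; toℕ)
import Data.Fin.Properties as Fin
open import Data.Integer.Base as ℤ using (ℤ; +_; -[1+_]; ∣_∣; 0ℤ; 1ℤ; -1ℤ)
import Data.Integer.Divisibility.Signed as ℤ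
import Data.Integer.Properties as ℤ
import Data.Integer.Solver as ℤ
open import Data.List.Base using (List; _∷_; [])
open import Data.List.Membership.Propositional using (_∈_)
import Data.List.Relation.Unary.All as All
open import Data.Maybe.Base using (Maybe; just; nothing)
open import Data.Nat.Base as ℕ using (ℕ; zero; suc; _≤_; _<_; z≤n; s≤s)
import Data.Nat.Divisibility as ℕ
import Data.Nat.DivMod as ℕ
import Data.Nat.Properties as ℕ
import Data.Nat.Solver as ℕ
open import Data.Product.Base using (∃; _×_; _,_; proj₁; proj₂)
open import Data.Sum.Base using (_⊎_; inj₁; inj₂)
open import Function.Base using (_∘_; flip)
open import Level using (_⊔_)
open import Relation.Binary.PropositionalEquality as ≡ using (_≡_; _≢_; _≗_; refl)
open import Relation.Binary.Structures using (IsEquivalence)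
import Relation.Binary.Reasoning.Setoid as SetoidReasoning
open import Relation.Nullary.Decidable using (yes; no; ¬?; _→-dec_; _×-dec_; from-yes)
open import Relation.Nullary.Negation using (¬_; contradiction)

-- All identities are proved modulo a power of q, in an abstract algebra. There infinite products
-- and theta series become finite, a sum converges when it is eventually constant, f₄ is a unit, and
-- the triple product is the limit of an exact identity between Gaussian binomials. For the
-- coefficient of q^n, order n + 1 is enough. The constants 3, -3, 1 come from 1 - (1 - h)³ = 3h -
-- 3h² + h³ at h = g²: this polynomial has no constant term, so E itself is traded for E g², E g⁴, E
-- g⁶, each a product of two sparse series. The obstacle is ρ, whose product formula is a limiting
-- case of the quintuple product identity. It is drawn from f₄ρ = f₂³g, where the right side is a
-- double sum with exponent m(m - 1) + 2l² and weight m. Grouped by N = m + 2l, every row becomes f₄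
-- times a single term or 0. For this the weight must be constant along a row, so m has to be
-- replaced by N; the error is a multiple of Σ (-1)^m q^{m(m-1)} = 0.

ℤ-induction : ∀ {p} (P : ℤ → Set p) → P 0ℤ →
              (∀ j → P j → P (ℤ.suc j)) → (∀ j → P j → P (ℤ.pred j)) → ∀ j → P j
ℤ-induction P P0 up down (+ zero)      = P0
ℤ-induction P P0 up down (+ suc n)     = up (+ n) (ℤ-induction P P0 up down (+ n))
ℤ-induction P P0 up down -[1+ zero ]   = down 0ℤ P0
ℤ-induction P P0 up down -[1+ suc n ]  = down -[1+ n ] (ℤ-induction P P0 up down -[1+ n ])

-- Sums over antidiagonals and eventually constant sums over the integers

module Sums {c ℓ} (R : CommutativeRing c ℓ) where
  open CommutativeRing R hiding (refl)
  open CommutativeRing R using () renaming (refl to ≈-refl)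
  open SetoidReasoning setoid
  open import Algebra.Properties.CommutativeSemigroup +-commutativeSemigroup
    using (interchange; x∙yz≈y∙xz)

  -- asum M h = Σ_{k+l=M} h k l
  asum : ℕ → (ℕ → ℕ → Carrier) → Carrier
  asum zero    h = h 0 0
  asum (suc M) h = h 0 (suc M) + asum M (λ k l → h (suc k) l)

  asum-cong : ∀ M {h h′} → (∀ k l → k ℕ.+ l ≡ M → h k l ≈ h′ k l) → asum M h ≈ asum M h′
  asum-cong zero    e = e 0 0 refl
  asum-cong (suc M) e =
    +-cong (e 0 (suc M) refl) (asum-cong M λ k l p → e (suc k) l (≡.cong suc p))

  asum-+ : ∀ M h h′ → asum M (λ k l → h k l + h′ k l) ≈ asum M h + asum M h′
  asum-+ zero    h h′ = ≈-refl
  asum-+ (suc M) h h′ = trans (+-congˡ (asum-+ M _ _)) (interchange _ _ _ _)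

  asum-*ˡ : ∀ M a h → asum M (λ k l → a * h k l) ≈ a * asum M h
  asum-*ˡ zero    a h = ≈-refl
  asum-*ˡ (suc M) a h = trans (+-congˡ (asum-*ˡ M a _)) (sym (distribˡ a _ _))

  asum-snoc : ∀ M h → asum (suc M) h ≈ asum M (λ k l → h k (suc l)) + h (suc M) 0
  asum-snoc zero    h = ≈-refl
  asum-snoc (suc M) h = begin
    h 0 (2 ℕ.+ M) + asum (suc M) (λ k l → h (suc k) l)
      ≈⟨ +-congˡ (asum-snoc M (λ k → h (suc k))) ⟩
    h 0 (2 ℕ.+ M) + (asum M (λ k l → h (suc k) (suc l)) + h (2 ℕ.+ M) 0)
      ≈⟨ +-assoc _ _ _ ⟨
    asum (suc M) (λ k l → h k (suc l)) + h (2 ℕ.+ M) 0 ∎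

  asum-flip : ∀ M h → asum M h ≈ asum M (flip h)
  asum-flip zero    h = ≈-refl
  asum-flip (suc M) h = begin
    h 0 (suc M) + asum M (λ k l → h (suc k) l)  ≈⟨ +-congˡ (asum-flip M _) ⟩
    h 0 (suc M) + asum M (λ l k → h (suc k) l)  ≈⟨ +-comm _ _ ⟩
    asum M (λ l k → h (suc k) l) + h 0 (suc M)  ≈⟨ asum-snoc M (flip h) ⟨
    asum (suc M) (flip h)                       ∎

  -- Both groupings run over all i + j + l = M; over ℤ this becomes the associativity of the Cauchy
  -- product.
  asum-assoc : ∀ M (h : ℕ → ℕ → ℕ → Carrier) →
    asum M (λ k l → asum k (λ i j → h i j l)) ≈ asum M (λ i k → asum k (λ j l → h i j l))
  asum-assoc zero    h = ≈-refl
  asum-assoc (suc M) h = begin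
    h 0 0 (suc M) + asum M (λ k l → h 0 (suc k) l + asum k (λ i j → h (suc i) j l))
      ≈⟨ +-congˡ (asum-+ M _ _) ⟩
    h 0 0 (suc M) + (asum M (λ k l → h 0 (suc k) l)
      + asum M (λ k l → asum k (λ i j → h (suc i) j l)))
      ≈⟨ +-assoc _ _ _ ⟨
    asum (suc M) (λ k l → h 0 k l) + asum M (λ k l → asum k (λ i j → h (suc i) j l))
      ≈⟨ +-congˡ (asum-assoc M _) ⟩
    asum (suc M) (λ k l → h 0 k l) + asum M (λ i k → asum k (λ j l → h (suc i) j l)) ∎

  sum< : ℕ → (ℕ → Carrier) → Carrier
  sum< zero    f = 0#
  sum< (suc n) f = sum< n f + f n

  sum<-cong : ∀ n {f g} → (∀ i → f i ≈ g i) → sum< n f ≈ sum< n g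
  sum<-cong zero    e = ≈-refl
  sum<-cong (suc n) e = +-cong (sum<-cong n e) (e n)

  sum<-+ : ∀ n f g → sum< n (λ i → f i + g i) ≈ sum< n f + sum< n g
  sum<-+ zero    f g = sym (+-identityˡ 0#)
  sum<-+ (suc n) f g = trans (+-congʳ (sum<-+ n f g)) (interchange _ _ _ _)

  sum<-0 : ∀ n → sum< n (λ _ → 0#) ≈ 0#
  sum<-0 zero    = ≈-refl
  sum<-0 (suc n) = trans (+-identityʳ _) (sum<-0 n)

  sum<-*ˡ : ∀ n a f → sum< n (λ i → a * f i) ≈ a * sum< n f
  sum<-*ˡ zero    a f = sym (zeroʳ a)
  sum<-*ˡ (suc n) a f = trans (+-congʳ (sum<-*ˡ n a f)) (sym (distribˡ a _ _))

  sum<-front : ∀ n f → sum< (suc n) f ≈ f 0 + sum< n (f ∘ suc)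
  sum<-front zero    f = +-comm _ _
  sum<-front (suc n) f = trans (+-congʳ (sum<-front n f)) (+-assoc _ _ _)

  sum<-thirds : ∀ n f → sum< (n ℕ.* 3) f ≈
                sum< n (λ i → f (i ℕ.* 3) + f (1 ℕ.+ i ℕ.* 3) + f (2 ℕ.+ i ℕ.* 3))
  sum<-thirds zero    f = ≈-refl
  sum<-thirds (suc n) f = begin
    sum< (n ℕ.* 3) f + f (n ℕ.* 3) + f (1 ℕ.+ n ℕ.* 3) + f (2 ℕ.+ n ℕ.* 3)
      ≈⟨ +-congʳ (+-assoc _ _ _) ⟩
    sum< (n ℕ.* 3) f + (f (n ℕ.* 3) + f (1 ℕ.+ n ℕ.* 3)) + f (2 ℕ.+ n ℕ.* 3)
      ≈⟨ +-assoc _ _ _ ⟩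
    sum< (n ℕ.* 3) f + (f (n ℕ.* 3) + f (1 ℕ.+ n ℕ.* 3) + f (2 ℕ.+ n ℕ.* 3))
      ≈⟨ +-congʳ (sum<-thirds n f) ⟩
    _ ∎

  opaque
    -- Σ_{-a ≤ j < b} f j
    bsum : ℕ → ℕ → (ℤ → Carrier) → Carrier
    bsum a b f = sum< a (λ i → f -[1+ i ]) + sum< b (λ i → f (+ i))

    bsum-def : ∀ a b f → bsum a b f ≈ sum< a (λ i → f -[1+ i ]) + sum< b (λ i → f (+ i))
    bsum-def a b f = ≈-refl

    bsum-cong : ∀ a b {f g} → (∀ j → f j ≈ g j) → bsum a b f ≈ bsum a b g
    bsum-cong a b e = +-cong (sum<-cong a λ i → e -[1+ i ]) (sum<-cong b λ i → e (+ i))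

    bsum-+ : ∀ a b f g → bsum a b (λ j → f j + g j) ≈ bsum a b f + bsum a b g
    bsum-+ a b f g = trans (+-cong (sum<-+ a _ _) (sum<-+ b _ _)) (interchange _ _ _ _)

    bsum-0 : ∀ a b → bsum a b (λ _ → 0#) ≈ 0#
    bsum-0 a b = trans (+-cong (sum<-0 a) (sum<-0 b)) (+-identityˡ 0#)

    bsum-*ˡ : ∀ a b u f → bsum a b (λ j → u * f j) ≈ u * bsum a b f
    bsum-*ˡ a b u f = trans (+-cong (sum<-*ˡ a u _) (sum<-*ˡ b u _)) (sym (distribˡ u _ _))

    bsum-suc : ∀ a b f → bsum (suc a) b (f ∘ ℤ.suc) ≈ bsum a (suc b) f
    bsum-suc a b f = begin
      sum< (suc a) (λ i → f (ℤ.suc -[1+ i ])) + sum< b (λ i → f (+ suc i))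
        ≈⟨ +-congʳ (sum<-front a _) ⟩
      f 0ℤ + sum< a (λ i → f -[1+ i ]) + sum< b (λ i → f (+ suc i))
        ≈⟨ +-congʳ (+-comm _ _) ⟩
      sum< a (λ i → f -[1+ i ]) + f 0ℤ + sum< b (λ i → f (+ suc i))
        ≈⟨ +-assoc _ _ _ ⟩
      sum< a (λ i → f -[1+ i ]) + (f 0ℤ + sum< b (λ i → f (+ suc i)))
        ≈⟨ +-congˡ (sum<-front b _) ⟨
      bsum a (suc b) f ∎

  bsum-pred : ∀ a b f → bsum a (suc b) (f ∘ ℤ.pred) ≈ bsum (suc a) b f
  bsum-pred a b f = begin
    bsum a (suc b) (f ∘ ℤ.pred)            ≈⟨ bsum-suc a b _ ⟨
    bsum (suc a) b (f ∘ ℤ.pred ∘ ℤ.suc)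
      ≈⟨ bsum-cong (suc a) b (λ j → reflexive (≡.cong f (ℤ.pred-suc j))) ⟩
    bsum (suc a) b f                       ∎

  opaque
    unfolding bsum

    -- Reflection turns the window -a ≤ j ≤ b into -b ≤ j ≤ a; the half-open convention of `bsum`
    -- puts `suc` on each upper bound.
    bsum-neg : ∀ a b f → bsum a (suc b) (f ∘ ℤ.-_) ≈ bsum b (suc a) f
    bsum-neg a b f = begin
      sum< a (λ i → f (+ suc i)) + sum< (suc b) (λ i → f (ℤ.- + i))
        ≈⟨ +-congˡ (sum<-front b _) ⟩
      sum< a (λ i → f (+ suc i)) + (f 0ℤ + sum< b (λ i → f -[1+ i ]))
        ≈⟨ +-assoc _ _ _ ⟨
      sum< a (λ i → f (+ suc i)) + f 0ℤ + sum< b (λ i → f -[1+ i ])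
        ≈⟨ +-congʳ (+-comm _ _) ⟩
      f 0ℤ + sum< a (λ i → f (+ suc i)) + sum< b (λ i → f -[1+ i ])
        ≈⟨ +-congʳ (sum<-front a _) ⟨
      sum< (suc a) (λ i → f (+ i)) + sum< b (λ i → f -[1+ i ])
        ≈⟨ +-comm _ _ ⟩
      bsum b (suc a) f ∎

    bsum-exchange : ∀ a b a′ b′ (F : ℤ → ℤ → Carrier) →
      bsum a b (λ m → bsum a′ b′ (F m)) ≈ bsum a′ b′ (λ l → bsum a b (λ m → F m l))
    bsum-exchange a b a′ b′ F = begin
      bsum a b (λ m → bsum a′ b′ (F m))
        ≈⟨ +-cong (sum<-bsum a (λ i → F -[1+ i ])) (sum<-bsum b (λ i → F (+ i))) ⟩
      bsum a′ b′ (λ l → sum< a (λ i → F -[1+ i ] l)) + bsum a′ b′ (λ l → sum< b (λ i → F (+ i) l))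
        ≈⟨ bsum-+ a′ b′ (λ l → sum< a (λ i → F -[1+ i ] l)) (λ l → sum< b (λ i → F (+ i) l)) ⟨
      bsum a′ b′ (λ l → bsum a b (λ m → F m l)) ∎
      where
      sum<-bsum : ∀ n (G : ℕ → ℤ → Carrier) →
        sum< n (λ i → bsum a′ b′ (G i)) ≈ bsum a′ b′ (λ l → sum< n (λ i → G i l))
      sum<-bsum zero    G = sym (bsum-0 a′ b′)
      sum<-bsum (suc n) G = trans (+-congʳ (sum<-bsum n G))
          (sym (bsum-+ a′ b′ (λ l → sum< n (λ i → G i l)) (G n)))

    -- The passage from the finite triple product, a sum over an antidiagonal, to a bilateral sum: k
    -- - n runs from -n to m.
    asum-bsum : ∀ n m f → asum (n ℕ.+ m) (λ k _ → f (k ℤ.⊖ n)) ≈ bsum n (suc m) f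
    asum-bsum zero zero    f = sym (trans (+-identityˡ _) (+-identityˡ _))
    asum-bsum zero (suc m) f = begin
      asum (suc m) (λ k _ → f (k ℤ.⊖ 0))                     ≈⟨ asum-snoc m (λ k _ → f (k ℤ.⊖ 0)) ⟩
      asum m (λ k _ → f (k ℤ.⊖ 0)) + f (+ suc m)             ≈⟨ +-congʳ (asum-bsum 0 m f) ⟩
      0# + sum< (suc m) (λ i → f (+ i)) + f (+ suc m)        ≈⟨ +-assoc _ _ _ ⟩
      bsum 0 (2 ℕ.+ m) f                                     ∎
    asum-bsum (suc n) m f = begin
      f -[1+ n ] + asum (n ℕ.+ m) (λ k _ → f (suc k ℤ.⊖ suc n))
        ≈⟨ +-congˡ (asum-cong (n ℕ.+ m) λ k l _ → reflexive (≡.cong f (ℤ.[1+m]⊖[1+n]≡m⊖n k n))) ⟩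
      f -[1+ n ] + asum (n ℕ.+ m) (λ k _ → f (k ℤ.⊖ n))
        ≈⟨ +-congˡ (asum-bsum n m f) ⟩
      f -[1+ n ] + (sum< n (λ i → f -[1+ i ]) + sum< (suc m) (λ i → f (+ i)))
        ≈⟨ +-assoc _ _ _ ⟨
      f -[1+ n ] + sum< n (λ i → f -[1+ i ]) + sum< (suc m) (λ i → f (+ i))
        ≈⟨ +-congʳ (+-comm _ _) ⟩
      bsum (suc n) (suc m) f ∎

  infix 4 _⇓_
  -- Convergence in the discrete sense. The two ends vary independently, so it survives shifts,
  -- which move them in opposite directions, and reflections, which swap them.
  record _⇓_ (f : ℤ → Carrier) (v : Carrier) : Set ℓ where
    constructor _,_
    field
      bound : ℕ
      value : ∀ a b → bound ≤ a → bound ≤ b → bsum a b f ≈ v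

  Supported : ℕ → (ℤ → Carrier) → Set ℓ
  Supported K f = ∀ j → K ≤ ∣ j ∣ → f j ≈ 0#

  opaque
    unfolding bsum

    bsum-supported : ∀ {K f} → Supported K f → ∀ {a b} → K ≤ a → K ≤ b → bsum a b f ≈ bsum K K f
    bsum-supported {K} {f} sup K≤a K≤b =
      +-cong (tail _ (λ i K≤i → sup -[1+ i ] (ℕ.m≤n⇒m≤1+n K≤i)) (ℕ.≤⇒≤′ K≤a))
             (tail _ (λ i K≤i → sup (+ i) K≤i) (ℕ.≤⇒≤′ K≤b))
      where
      tail : ∀ g → (∀ i → K ≤ i → g i ≈ 0#) → ∀ {a} → K ℕ.≤′ a → sum< a g ≈ sum< K g
      tail g z ℕ.≤′-refl     = ≈-refl
      tail g z (ℕ.≤′-step p) = trans (+-cong (tail g z p) (z _ (ℕ.≤′⇒≤ p))) (+-identityʳ _)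

  supported⇒⇓ : ∀ {K f} → Supported K f → f ⇓ bsum K K f
  supported⇒⇓ {K} sup = K , λ a b → bsum-supported sup {a} {b}

  ⇓-unique : ∀ {f u v} → f ⇓ u → f ⇓ v → u ≈ v
  ⇓-unique (K , p) (L , q) =
    trans (sym (p M M (ℕ.m≤m⊔n K L) (ℕ.m≤m⊔n K L))) (q M M (ℕ.m≤n⊔m K L) (ℕ.m≤n⊔m K L))
    where M = K ℕ.⊔ L

  ⇓-cong : ∀ {f g u v} → (∀ j → f j ≈ g j) → u ≈ v → f ⇓ u → g ⇓ v
  ⇓-cong e u≈v (K , p) = K , λ a b K≤a K≤b →
    trans (bsum-cong a b (λ j → sym (e j))) (trans (p a b K≤a K≤b) u≈v)

  ⇓-congˡ : ∀ {f g u} → (∀ j → f j ≈ g j) → f ⇓ u → g ⇓ u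
  ⇓-congˡ e = ⇓-cong e ≈-refl

  ⇓-+ : ∀ {f g u v} → f ⇓ u → g ⇓ v → (λ j → f j + g j) ⇓ u + v
  ⇓-+ (K , p) (L , q) = K ℕ.⊔ L , λ a b M≤a M≤b → trans (bsum-+ a b _ _)
    (+-cong (p a b (ℕ.m⊔n≤o⇒m≤o K L M≤a) (ℕ.m⊔n≤o⇒m≤o K L M≤b))
            (q a b (ℕ.m⊔n≤o⇒n≤o K L M≤a) (ℕ.m⊔n≤o⇒n≤o K L M≤b)))

  ⇓-*ˡ : ∀ a {f u} → f ⇓ u → (λ j → a * f j) ⇓ a * u
  ⇓-*ˡ a (K , p) = K , λ b c K≤b K≤c → trans (bsum-*ˡ b c a _) (*-congˡ (p b c K≤b K≤c))

  ⇓-suc : ∀ {f u} → f ⇓ u → f ∘ ℤ.suc ⇓ u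
  ⇓-suc (K , p) = suc K , λ where
    (suc a) b (s≤s K≤a) K<b → trans (bsum-suc a b _)
      (p a (suc b) K≤a (ℕ.m≤n⇒m≤1+n (ℕ.<⇒≤ K<b)))

  ⇓-pred : ∀ {f u} → f ⇓ u → f ∘ ℤ.pred ⇓ u
  ⇓-pred (K , p) = suc K , λ where
    a (suc b) K<a (s≤s K≤b) → trans (bsum-pred a b _)
      (p (suc a) b (ℕ.m≤n⇒m≤1+n (ℕ.<⇒≤ K<a)) K≤b)

  ⇓-shift : ∀ i {f u} → f ⇓ u → (λ j → f (i ℤ.+ j)) ⇓ u
  ⇓-shift = ℤ-induction _
    (λ {f} p → ⇓-congˡ (λ j → reflexive (≡.cong f (≡.sym (ℤ.+-identityˡ j)))) p)
    (λ i ih {f} p → ⇓-congˡ (λ j → reflexive (≡.cong f (≡.sym (ℤ.+-assoc 1ℤ i j)))) (ih (⇓-suc p)))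
    (λ i ih {f} p → ⇓-congˡ (λ j → reflexive (≡.cong f (≡.sym (ℤ.+-assoc -1ℤ i j)))) (ih (⇓-pred p)))

  ⇓-neg : ∀ {f u} → f ⇓ u → f ∘ ℤ.-_ ⇓ u
  ⇓-neg (K , p) = suc K , λ where
    a (suc b) K<a (s≤s K≤b) → trans (bsum-neg a b _) (p b (suc a) K≤b (ℕ.m≤n⇒m≤1+n (ℕ.<⇒≤ K<a)))

  opaque
    unfolding bsum

    -- The blocks of three tile the window from -3a to 3b exactly, so there are no boundary terms;
    -- on the negative side each block appears in reverse order.
    ⇓-thirds : ∀ {f u} → f ⇓ u →
      (λ j → f (j ℤ.* + 3) + f (1ℤ ℤ.+ j ℤ.* + 3) + f (+ 2 ℤ.+ j ℤ.* + 3)) ⇓ u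
    ⇓-thirds {f} {u} (K , p) = K , λ a b K≤a K≤b → begin
      sum< a (λ i → g -[1+ i ]) + sum< b (λ i → g (+ i))
        ≈⟨ +-cong (sum<-cong a neg) (sum<-cong b pos) ⟩
      sum< a (λ i → f -[1+ i ℕ.* 3 ] + f -[1+ suc (i ℕ.* 3) ] + f -[1+ 2 ℕ.+ i ℕ.* 3 ])
        + sum< b (λ i → f (+ (i ℕ.* 3)) + f (+ (1 ℕ.+ i ℕ.* 3)) + f (+ (2 ℕ.+ i ℕ.* 3)))
        ≈⟨ +-cong (sum<-thirds a _) (sum<-thirds b _) ⟨
      bsum (a ℕ.* 3) (b ℕ.* 3) f
        ≈⟨ p (a ℕ.* 3) (b ℕ.* 3) (ℕ.≤-trans K≤a (ℕ.m≤m*n a 3)) (ℕ.≤-trans K≤b (ℕ.m≤m*n b 3)) ⟩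
      u ∎
      where
      g : ℤ → Carrier
      g j = f (j ℤ.* + 3) + f (1ℤ ℤ.+ j ℤ.* + 3) + f (+ 2 ℤ.+ j ℤ.* + 3)
      pos : ∀ i → g (+ i) ≈
            f (+ (i ℕ.* 3)) + f (+ (1 ℕ.+ i ℕ.* 3)) + f (+ (2 ℕ.+ i ℕ.* 3))
      pos i = reflexive (≡.cong (λ k → f k + f (1ℤ ℤ.+ k) + f (+ 2 ℤ.+ k)) (≡.sym (ℤ.pos-* i 3)))
      neg : ∀ i → g -[1+ i ] ≈
            f -[1+ i ℕ.* 3 ] + f -[1+ suc (i ℕ.* 3) ] + f -[1+ 2 ℕ.+ i ℕ.* 3 ]
      neg i = trans (+-comm _ _) (trans (+-congˡ (+-comm _ _)) (sym (+-assoc _ _ _)))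

  Boxed : ℕ → (ℤ → ℤ → Carrier) → Set ℓ
  Boxed K F = ∀ m l → K ≤ ∣ m ∣ ⊎ K ≤ ∣ l ∣ → F m l ≈ 0#

  -- All nonzero terms lie in the box ∣ m ∣, ∣ l ∣ < K, so both iterated sums are one finite sum.
  ⇓-fubini : ∀ {K F r v} → Boxed K F → (∀ m → F m ⇓ r m) → r ⇓ v →
             ∀ {c} → (∀ l → (λ m → F m l) ⇓ c l) → c ⇓ v
  ⇓-fubini {K} {F} {r} {v} box rows (L , p) {c} columns = K , λ a b K≤a K≤b → begin
    bsum a b c
      ≈⟨ bsum-cong a b (λ l → ⇓-unique (columns l) (supported⇒⇓ (λ m q → box m l (inj₁ q)))) ⟩
    bsum a b (λ l → bsum K K (λ m → F m l))
      ≈⟨ bsum-exchange K K a b F ⟨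
    bsum K K (λ m → bsum a b (F m))
      ≈⟨ bsum-cong K K (λ m → bsum-supported (λ l q → box m l (inj₂ q)) K≤a K≤b) ⟩
    bsum K K (λ m → bsum K K (F m))
      ≈⟨ bsum-cong K K (λ m → ⇓-unique (supported⇒⇓ (λ l q → box m l (inj₂ q))) (rows m)) ⟩
    bsum K K r
      ≈⟨ ⇓-unique (supported⇒⇓ r-supported) (L , p) ⟩
    v ∎
    where
    r-supported : Supported K r
    r-supported m q = ⇓-unique (rows m) (0 , λ a b _ _ →
      trans (bsum-cong a b (λ l → box m l (inj₁ q))) (bsum-0 a b))

  opaque
    unfolding bsum

    -- The involution j ↦ -1 - j maps the window -K ≤ j < K to itself without fixed points, so terms
    -- cancel in pairs and no cancellation of a factor 2 is involved.
    ⇓-antisymmetric : ∀ {K f} → Supported K f → (∀ j → f (-1ℤ ℤ.- j) ≈ - f j) → f ⇓ 0#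
    ⇓-antisymmetric {K} {f} sup anti = ⇓-cong (λ _ → ≈-refl) cancel (supported⇒⇓ sup)
      where
      cancel : bsum K K f ≈ 0#
      cancel = begin
        sum< K (λ i → f -[1+ i ]) + sum< K (λ i → f (+ i))
          ≈⟨ sum<-+ K _ _ ⟨
        sum< K (λ i → f -[1+ i ] + f (+ i))
          ≈⟨ sum<-cong K (λ i → trans
               (+-congʳ (trans (reflexive (≡.cong f (reflect i))) (anti (+ i)))) (-‿inverseˡ _)) ⟩
        sum< K (λ _ → 0#)
          ≈⟨ sum<-0 K ⟩
        0# ∎
        where
        reflect : ∀ i → -[1+ i ] ≡ -1ℤ ℤ.- + i
        reflect zero    = refl
        reflect (suc i) = refl

    -- The terms at j and -j coincide; this is the source of g = 1 + 2u.
    ⇓-even : ∀ {K f} → Supported K f → (∀ j → f (ℤ.- j) ≈ f j) →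
             ∃ λ u → f ⇓ f 0ℤ + (u + u)
    ⇓-even {K} {f} sup even = u , ⇓-cong (λ _ → ≈-refl) double
      -- The window is taken as -K ≤ j ≤ K, one longer on the right, to be symmetric about 0.
      (K , λ a b K≤a K≤b → trans (bsum-supported {K} {f} sup {a} {b} K≤a K≤b)
                                 (sym (bsum-supported {K} {f} sup {K} {suc K} ℕ.≤-refl (ℕ.n≤1+n K))))
      where
      u : Carrier
      u = sum< K (λ i → f (+ suc i))
      double : bsum K (suc K) f ≈ f 0ℤ + (u + u)
      double = begin
        sum< K (λ i → f -[1+ i ]) + sum< (suc K) (λ i → f (+ i))
          ≈⟨ +-cong (sum<-cong K (λ i → even (+ suc i))) (sum<-front K _) ⟩
        u + (f 0ℤ + u)
          ≈⟨ x∙yz≈y∙xz u (f 0ℤ) u ⟩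
        f 0ℤ + (u + u) ∎

-- Truncated series: units, infinite products, Gaussian binomials

-- A commutative ℤ-algebra with the powers of an element q, where q^n = 0 for n ≥ order:
-- ℤ[[q]] modulo q^order is the example to have in mind.
record TruncatedAlgebra c ℓ : Set (Level.suc (c ⊔ ℓ)) where
  field
    baseRing : CommutativeRing c ℓ
    const    : ℤ.+-*-rawRing -Raw-AlmostCommutative⟶ fromCommutativeRing baseRing

  open CommutativeRing baseRing

  field
    pow    : ℕ → Carrier
    pow-0   : pow 0 ≈ 1#
    pow-+  : ∀ m n → pow (m ℕ.+ n) ≈ pow m * pow n
    order : ℕ
    pow-≥  : ∀ n → order ≤ n → pow n ≈ 0#

module Ring {c ℓ} (T : TruncatedAlgebra c ℓ) where
  open TruncatedAlgebra T public
  open CommutativeRing baseRing hiding (refl; zero) public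
  open CommutativeRing baseRing using () renaming (refl to ≈-refl) public
  open _-Raw-AlmostCommutative⟶_ const public
  open Sums baseRing public
  open SetoidReasoning setoid

  private
    _≟⟦⟧_ : ∀ i j → Maybe (⟦ i ⟧ ≈ ⟦ j ⟧)
    i ≟⟦⟧ j with i ℤ.≟ j
    ... | yes refl = just ≈-refl
    ... | no _     = nothing

  open import Algebra.Solver.Ring ℤ.+-*-rawRing (fromCommutativeRing baseRing) const _≟⟦⟧_ public
    using (solve; _:=_; _:+_; _:*_; _:-_; :-_; con)

  Unit : Carrier → Set _
  Unit u = ∃ λ v → u * v ≈ 1#

  unit-* : ∀ {u v} → Unit u → Unit v → Unit (u * v)
  unit-* {u} {v} (u⁻¹ , p) (v⁻¹ , q) = u⁻¹ * v⁻¹ , (begin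
    u * v * (u⁻¹ * v⁻¹)    ≈⟨ solve 4 (λ a b c d → a :* b :* (c :* d) := a :* c :* (b :* d))
                                ≈-refl u v u⁻¹ v⁻¹ ⟩
    u * u⁻¹ * (v * v⁻¹)    ≈⟨ *-cong p q ⟩
    1# * 1#                ≈⟨ *-identityˡ 1# ⟩
    1#                     ∎)

  unit-cancel : ∀ {u y z} → Unit u → u * y ≈ u * z → y ≈ z
  unit-cancel {u} {y} {z} (u⁻¹ , p) e = begin
    y               ≈⟨ lemma y ⟨
    u⁻¹ * (u * y)   ≈⟨ *-congˡ e ⟩
    u⁻¹ * (u * z)   ≈⟨ lemma z ⟩
    z               ∎
    where
    lemma : ∀ y → u⁻¹ * (u * y) ≈ y
    lemma y = trans (sym (*-assoc _ _ _))
      (trans (*-congʳ (trans (*-comm _ _) p)) (*-identityˡ y))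

  1-pow : ℕ → Carrier
  1-pow e = 1# - pow e

  1-pow-≥ : ∀ {e} → order ≤ e → 1-pow e ≈ 1#
  1-pow-≥ {e} p = trans (+-congˡ (-‿cong (pow-≥ e p)))
    (trans (+-congˡ -0#≈0#) (+-identityʳ 1#))
    where
    open import Algebra.Properties.Ring ring using (-0#≈0#)

  -- The geometric series is the inverse; it may stop after `order` terms because its remainder
  -- q^(e·order) is 0.
  unit-1-pow : ∀ e .{{_ : ℕ.NonZero e}} → Unit (1# - pow e)
  unit-1-pow e = geometric order , trans (telescope order)
    (1-pow-≥ (ℕ.m≤n*m order e))
    where
    geometric : ℕ → Carrier
    geometric n = sum< n (λ i → pow (e ℕ.* i))
    telescope : ∀ n → (1# - pow e) * geometric n ≈ 1# - pow (e ℕ.* n)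
    telescope zero = begin
      (1# - pow e) * 0#     ≈⟨ zeroʳ _ ⟩
      0#                   ≈⟨ -‿inverseʳ 1# ⟨
      1# - 1#              ≈⟨ +-congˡ (-‿cong pow-0) ⟨
      1# - pow 0            ≈⟨ +-congˡ (-‿cong (reflexive (≡.cong pow (ℕ.*-zeroʳ e)))) ⟨
      1# - pow (e ℕ.* 0)    ∎
    telescope (suc n) = begin
      (1# - pow e) * (geometric n + pow (e ℕ.* n))
        ≈⟨ distribˡ _ _ _ ⟩
      (1# - pow e) * geometric n + (1# - pow e) * pow (e ℕ.* n)
        ≈⟨ +-cong (telescope n) (trans (distribʳ _ _ _) (+-congʳ (*-identityˡ _))) ⟩
      (1# - pow (e ℕ.* n)) + (pow (e ℕ.* n) + - pow e * pow (e ℕ.* n))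
        ≈⟨ solve 3 (λ o a b → (o :- b) :+ (b :+ :- a :* b) := o :- a :* b)
             ≈-refl 1# (pow e) (pow (e ℕ.* n)) ⟩
      1# - pow e * pow (e ℕ.* n)
        ≈⟨ +-congˡ (-‿cong (pow-+ e (e ℕ.* n))) ⟨
      1# - pow (e ℕ.+ e ℕ.* n)
        ≈⟨ +-congˡ (-‿cong (reflexive (≡.cong pow (ℕ.*-suc e n)))) ⟨
      1# - pow (e ℕ.* suc n) ∎

  prod : (ℕ → Carrier) → ℕ → Carrier
  prod f zero    = 1#
  prod f (suc n) = f n * prod f n

  prod-unit : ∀ {f} → (∀ i → Unit (f i)) → ∀ n → Unit (prod f n)
  prod-unit u zero    = 1# , *-identityˡ 1#
  prod-unit u (suc n) = unit-* (u n) (prod-unit u n)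

  prod-cong : ∀ {f g} → (∀ i → f i ≈ g i) → ∀ n → prod f n ≈ prod g n
  prod-cong e zero    = ≈-refl
  prod-cong e (suc n) = *-cong (e n) (prod-cong e n)

  -- A factor with index i ≥ order has exponent at least i and so equals 1; the product of `order`
  -- factors can thus stand for the infinite one.
  prod-stable : ∀ {e : ℕ → ℕ} → (∀ i → i ≤ e i) → ∀ {n} → order ≤ n →
                prod (1-pow ∘ e) n ≈ prod (1-pow ∘ e) order
  prod-stable {e} grows p = go (ℕ.≤⇒≤′ p)
    where
    go : ∀ {n} → order ℕ.≤′ n → prod (1-pow ∘ e) n ≈ prod (1-pow ∘ e) order
    go ℕ.≤′-refl          = ≈-refl
    go (ℕ.≤′-step {n} p′) = trans
      (*-congʳ (1-pow-≥ (ℕ.≤-trans (ℕ.≤′⇒≤ p′) (grows n))))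
      (trans (*-identityˡ _) (go p′))

  φ : ℕ → ℕ → Carrier
  φ k = prod (λ i → 1-pow (k ℕ.* suc i))

  φ∞ : ℕ → Carrier
  φ∞ k = φ k order

  φ-stable : ∀ k .{{_ : ℕ.NonZero k}} {n} → order ≤ n → φ k n ≈ φ∞ k
  φ-stable k = prod-stable λ i → ℕ.≤-trans (ℕ.n≤1+n i) (ℕ.m≤n*m (suc i) k)

  φ-unit : ∀ k .{{_ : ℕ.NonZero k}} n → Unit (φ k n)
  φ-unit k = prod-unit λ i → unit-1-pow (k ℕ.* suc i) {{ℕ.m*n≢0 k (suc i)}}

  -- Gaussian binomials bin k l = [k+l choose k] in the base p 1.
  module Gaussian (p : ℕ → Carrier) (p-0 : p 0 ≈ 1#)
                  (p-+ : ∀ k l → p (k ℕ.+ l) ≈ p k * p l) where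

    bin : ℕ → ℕ → Carrier
    bin zero    l       = 1#
    bin (suc k) zero    = 1#
    bin (suc k) (suc l) = p (suc l) * bin k (suc l) + bin (suc k) l

    p-cong : ∀ {k l} → k ≡ l → p k ≈ p l
    p-cong e = reflexive (≡.cong p e)

    gsum : ℕ → (ℕ → ℕ → Carrier) → Carrier
    gsum M g = asum M (λ k l → g k l * bin k l)

    gsum-cong : ∀ M {g h} → (∀ k l → k ℕ.+ l ≡ M → g k l ≈ h k l) → gsum M g ≈ gsum M h
    gsum-cong M e = asum-cong M (λ k l r → *-congʳ (e k l r))

    gsum-+ : ∀ M g h → gsum M (λ k l → g k l + h k l) ≈ gsum M g + gsum M h
    gsum-+ M g h = trans (asum-cong M λ k l _ → distribʳ _ _ _) (asum-+ M _ _)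

    gsum-*ˡ : ∀ M a g → gsum M (λ k l → a * g k l) ≈ a * gsum M g
    gsum-*ˡ M a g = trans (asum-cong M λ k l _ → *-assoc _ _ _) (asum-*ˡ M a _)

    -- Pascal's rule transposed: it acts on the weights g instead of the binomials, so the
    -- recurrences for theta sums become computations with exponents.
    pascalˡ : ∀ M g → gsum (suc M) g ≈ gsum M (λ k l → p l * g (suc k) l + g k (suc l))
    pascalˡ M g = begin
      g 0 (suc M) * 1# + asum M (λ k l → g (suc k) l * bin (suc k) l)
        ≈⟨ +-congˡ (trans (asum-cong M λ k l _ → split k l) (asum-+ M _ _)) ⟩
      H 0 (suc M) + (gsum M (λ k l → p l * g (suc k) l) + asum M (H ∘ suc))
        ≈⟨ solve 3 (λ a b c → a :+ (b :+ c) := b :+ (a :+ c)) ≈-refl _ _ _ ⟩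
      gsum M (λ k l → p l * g (suc k) l) + asum (suc M) H
        ≈⟨ +-congˡ (trans (asum-snoc M H) (+-identityʳ _)) ⟩
      gsum M (λ k l → p l * g (suc k) l) + gsum M (λ k l → g k (suc l))
        ≈⟨ gsum-+ M _ _ ⟨
      gsum M (λ k l → p l * g (suc k) l + g k (suc l)) ∎
      where
      -- `H` holds the second summand of Pascal's rule, and at k = 0 the boundary term. Its value 0
      -- at l = 0 makes the last term of its sum drop out.
      H : ℕ → ℕ → Carrier
      H k zero    = 0#
      H k (suc l) = g k (suc l) * bin k l
      split : ∀ k l → g (suc k) l * bin (suc k) l ≈ p l * g (suc k) l * bin k l + H (suc k) l
      split k zero = begin
        g (suc k) 0 * 1#                      ≈⟨ *-congʳ (*-identityˡ _) ⟨
        1# * g (suc k) 0 * 1#                 ≈⟨ *-cong (*-congʳ p-0) (bin-0 k) ⟨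
        p 0 * g (suc k) 0 * bin k 0           ≈⟨ +-identityʳ _ ⟨
        p 0 * g (suc k) 0 * bin k 0 + 0#      ∎
        where
        bin-0 : ∀ k → bin k 0 ≈ 1#
        bin-0 zero    = ≈-refl
        bin-0 (suc k) = ≈-refl
      split k (suc l) = solve 4 (λ a b c d → a :* (b :* c :+ d) := b :* a :* c :+ a :* d)
        ≈-refl (g (suc k) (suc l)) (p (suc l)) (bin k (suc l)) (bin (suc k) l)

    -- The operators D, D′ of the two Pascal rules commute, so one rule yields the other.
    pascalʳ : ∀ M g → gsum (suc M) g ≈ gsum M (λ k l → g (suc k) l + p k * g k (suc l))
    pascalʳ zero    g = trans (pascalˡ 0 g) (gsum-cong 0 base)
      where
      base : ∀ k l → k ℕ.+ l ≡ 0 →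
             p l * g (suc k) l + g k (suc l) ≈ g (suc k) l + p k * g k (suc l)
      base zero zero _ = +-cong (trans (*-congʳ p-0) (*-identityˡ _))
                                (sym (trans (*-congʳ p-0) (*-identityˡ _)))
    pascalʳ (suc M) g = begin
      gsum (2 ℕ.+ M) g                       ≈⟨ pascalˡ (suc M) g ⟩
      gsum (suc M) (D g)                     ≈⟨ pascalʳ M (D g) ⟩
      gsum M (D′ (D g))                      ≈⟨ gsum-cong M (λ k l _ → commute k l) ⟩
      gsum M (D (D′ g))                      ≈⟨ pascalˡ M (D′ g) ⟨
      gsum (suc M) (D′ g)                    ∎
      where
      D D′ : (ℕ → ℕ → Carrier) → ℕ → ℕ → Carrier
      D  h k l = p l * h (suc k) l + h k (suc l)
      D′ h k l = h (suc k) l + p k * h k (suc l)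
      exponents : ∀ k l → p k * p (suc l) ≈ p l * p (suc k)
      exponents k l = begin
        p k * p (suc l)     ≈⟨ p-+ k (suc l) ⟨
        p (k ℕ.+ suc l)     ≈⟨ p-cong (≡.trans (ℕ.+-comm k (suc l)) (≡.sym (ℕ.+-suc l k))) ⟩
        p (l ℕ.+ suc k)     ≈⟨ p-+ l (suc k) ⟩
        p l * p (suc k)     ∎
      commute : ∀ k l → D′ (D g) k l ≈ D (D′ g) k l
      commute k l = begin
        (p l * g₂₀ + g₁₁) + p k * (p (suc l) * g₁₁ + g₀₂)
          ≈⟨ solve 6 (λ pl pk pl′ a b c →
               (pl :* a :+ b) :+ pk :* (pl′ :* b :+ c) :=
               (pl :* a :+ pk :* pl′ :* b) :+ (b :+ pk :* c))
               ≈-refl (p l) (p k) (p (suc l)) g₂₀ g₁₁ g₀₂ ⟩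
        (p l * g₂₀ + p k * p (suc l) * g₁₁) + (g₁₁ + p k * g₀₂)
          ≈⟨ +-congʳ (+-congˡ (*-congʳ (exponents k l))) ⟩
        (p l * g₂₀ + p l * p (suc k) * g₁₁) + (g₁₁ + p k * g₀₂)
          ≈⟨ solve 6 (λ pl pk pk′ a b c →
               (pl :* a :+ pl :* pk′ :* b) :+ (b :+ pk :* c) :=
               pl :* (a :+ pk′ :* b) :+ (b :+ pk :* c))
               ≈-refl (p l) (p k) (p (suc k)) g₂₀ g₁₁ g₀₂ ⟩
        D (D′ g) k l ∎
        where
        g₂₀ = g (2 ℕ.+ k) l
        g₁₁ = g (suc k) (suc l)
        g₀₂ = g k (2 ℕ.+ l)

    factorial : ℕ → Carrier
    factorial = prod (λ i → 1# - p (suc i))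

    -- The quotient formula without division. The induction rests on 1 - p(k + l) = p(l) (1 - p(k))
    -- + (1 - p(l)).
    bin-factorial : ∀ k l → bin k l * (factorial k * factorial l) ≈ factorial (k ℕ.+ l)
    bin-factorial zero    l       = trans (*-identityˡ _) (*-identityˡ _)
    bin-factorial (suc k) zero    = trans (*-identityˡ _) (trans (*-identityʳ _)
      (reflexive (≡.cong factorial (≡.sym (ℕ.+-identityʳ (suc k))))))
    bin-factorial (suc k) (suc l) = begin
      (p (suc l) * bin k (suc l) + bin (suc k) l) *
      ((1# - p (suc k)) * factorial k * ((1# - p (suc l)) * factorial l))
        ≈⟨ solve 7 (λ o pl pk b c fk fl →
             (pl :* b :+ c) :* ((o :- pk) :* fk :* ((o :- pl) :* fl)) :=
             pl :* (o :- pk) :* (b :* (fk :* ((o :- pl) :* fl))) :+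
             (o :- pl) :* (c :* ((o :- pk) :* fk :* fl)))
             ≈-refl 1# (p (suc l)) (p (suc k)) (bin k (suc l)) (bin (suc k) l)
             (factorial k) (factorial l) ⟩
      p (suc l) * (1# - p (suc k)) * (bin k (suc l) * (factorial k * factorial (suc l))) +
      (1# - p (suc l)) * (bin (suc k) l * (factorial (suc k) * factorial l))
        ≈⟨ +-cong (*-congˡ (trans (bin-factorial k (suc l)) (reflexive (≡.cong factorial (ℕ.+-suc k l)))))
                  (*-congˡ (bin-factorial (suc k) l)) ⟩
      p (suc l) * (1# - p (suc k)) * F + (1# - p (suc l)) * F
        ≈⟨ solve 4 (λ o pl pk f →
             pl :* (o :- pk) :* f :+ (o :- pl) :* f := (pl :* o :- pl :* pk :+ (o :- pl)) :* f)
             ≈-refl 1# (p (suc l)) (p (suc k)) F ⟩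
      (p (suc l) * 1# - p (suc l) * p (suc k) + (1# - p (suc l))) * F
        ≈⟨ *-congʳ (trans (+-congʳ (+-cong (*-identityʳ _) (-‿cong exponents)))
             (solve 3 (λ o pl pm → pl :- pm :+ (o :- pl) := o :- pm)
               ≈-refl 1# (p (suc l)) (p (suc (k ℕ.+ suc l))))) ⟩
      (1# - p (suc (k ℕ.+ suc l))) * F
        ≈⟨ *-congˡ (reflexive (≡.cong factorial (≡.sym (ℕ.+-suc k l)))) ⟩
      factorial (suc k ℕ.+ suc l) ∎
      where
      F = factorial (suc k ℕ.+ l)
      exponents : p (suc l) * p (suc k) ≈ p (suc (k ℕ.+ suc l))
      exponents = trans (sym (p-+ (suc l) (suc k))) (p-cong (ℕ.+-comm (suc l) (suc k)))

-- Signs and quadratic bounds over the integers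

alternating : ℕ → ℤ
alternating zero    = 1ℤ
alternating (suc n) = ℤ.- alternating n

sgn : ℤ → ℤ
sgn j = alternating ∣ j ∣

sgn-suc : ∀ j → sgn (ℤ.suc j) ≡ ℤ.- sgn j
sgn-suc (+ n)          = refl
sgn-suc -[1+ zero ]    = refl
sgn-suc -[1+ suc n ]   = ≡.sym (ℤ.neg-involutive _)

sgn-pred : ∀ j → sgn (ℤ.pred j) ≡ ℤ.- sgn j
sgn-pred j = ≡.trans (≡.sym (ℤ.neg-involutive _))
  (≡.cong ℤ.-_ (≡.trans (≡.sym (sgn-suc (ℤ.pred j))) (≡.cong sgn (ℤ.suc-pred j))))

sgn-neg : ∀ j → sgn (ℤ.- j) ≡ sgn j
sgn-neg (+ zero)   = refl
sgn-neg (+ suc n)  = refl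
sgn-neg -[1+ n ]   = refl

sgn-+ : ∀ i j → sgn (i ℤ.+ j) ≡ sgn i ℤ.* sgn j
sgn-+ i j = ℤ-induction (λ i → sgn (i ℤ.+ j) ≡ sgn i ℤ.* sgn j)
  (≡.trans (≡.cong sgn (ℤ.+-identityˡ j)) (≡.sym (ℤ.*-identityˡ (sgn j))))
  (λ i ih → step ih (≡.trans (≡.cong sgn (ℤ.+-assoc 1ℤ i j)) (sgn-suc (i ℤ.+ j))) (sgn-suc i))
  (λ i ih → step ih (≡.trans (≡.cong sgn (ℤ.+-assoc -1ℤ i j)) (sgn-pred (i ℤ.+ j))) (sgn-pred i)) i
  where
  step : ∀ {a b c d e} → a ≡ b ℤ.* c → d ≡ ℤ.- a → e ≡ ℤ.- b → d ≡ e ℤ.* c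
  step {b = b} {c} refl refl refl = ℤ.neg-distribˡ-* b c

sgn-² : ∀ j → sgn j ℤ.* sgn j ≡ 1ℤ
sgn-² j = ≡.trans (≡.cong (sgn j ℤ.*_) (≡.sym (sgn-neg j)))
  (≡.trans (≡.sym (sgn-+ j (ℤ.- j))) (≡.cong sgn (ℤ.+-inverseʳ j)))

0≤j*j : ∀ j → 0ℤ ℤ.≤ j ℤ.* j
0≤j*j (+ n)    = ≡.subst (0ℤ ℤ.≤_) (ℤ.pos-* n n) (ℤ.+≤+ z≤n)
0≤j*j -[1+ n ] = ℤ.+≤+ z≤n

0≤j*[1+j] : ∀ j → 0ℤ ℤ.≤ j ℤ.* ℤ.suc j
0≤j*[1+j] (+ n)        = ≡.subst (0ℤ ℤ.≤_) (ℤ.pos-* n (suc n)) (ℤ.+≤+ z≤n)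
0≤j*[1+j] -[1+ zero ]  = ℤ.+≤+ z≤n
0≤j*[1+j] -[1+ suc n ] = ℤ.+≤+ z≤n

0≤j*[j-1] : ∀ j → 0ℤ ℤ.≤ j ℤ.* ℤ.pred j
0≤j*[j-1] (+ zero)  = ℤ.+≤+ z≤n
0≤j*[j-1] (+ suc n) = ≡.subst (0ℤ ℤ.≤_) (ℤ.pos-* (suc n) n) (ℤ.+≤+ z≤n)
0≤j*[j-1] -[1+ n ]  = ℤ.+≤+ z≤n

0≤n*i : ∀ n {i} → 0ℤ ℤ.≤ i → 0ℤ ℤ.≤ + n ℤ.* i
0≤n*i n (ℤ.+≤+ {n = k} _) = ≡.subst (0ℤ ℤ.≤_) (ℤ.pos-* n k) (ℤ.+≤+ z≤n)

abs-+ : ∀ {i j} → 0ℤ ℤ.≤ i → 0ℤ ℤ.≤ j → ∣ i ℤ.+ j ∣ ≡ ∣ i ∣ ℕ.+ ∣ j ∣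
abs-+ (ℤ.+≤+ _) (ℤ.+≤+ _) = refl

abs-shift : ∀ {a a′ i j} → 0ℤ ℤ.≤ i → 0ℤ ℤ.≤ j → + a ℤ.+ i ≡ + a′ ℤ.+ j →
            a ℕ.+ ∣ i ∣ ≡ a′ ℕ.+ ∣ j ∣
abs-shift (ℤ.+≤+ _) (ℤ.+≤+ _) e = ℤ.+-injective e

∣j∣≤1+∣j*[j-1]∣ : ∀ j → ∣ j ∣ ≤ suc ∣ j ℤ.* ℤ.pred j ∣
∣j∣≤1+∣j*[j-1]∣ (+ zero)        = z≤n
∣j∣≤1+∣j*[j-1]∣ (+ suc zero)    = s≤s z≤n
∣j∣≤1+∣j*[j-1]∣ (+ suc (suc n)) = ℕ.m≤n⇒m≤1+n (ℕ.m≤m*n (2 ℕ.+ n) (suc n))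
∣j∣≤1+∣j*[j-1]∣ -[1+ n ]        = ℕ.m≤n⇒m≤1+n (ℕ.m≤m*n (suc n) (2 ℕ.+ n))

-- For `theta-limit`: around the centre 2N + 1, an index too small for its binomial to have
-- stabilised is so far out that its theta term vanishes.
N<∣k-[2N+1]∣ : ∀ {k N} → k < N → N < ∣ + k ℤ.- + (N ℕ.+ suc N) ∣
N<∣k-[2N+1]∣ {k} {N} k<N = begin
  suc N                         ≤⟨ ℕ.m≤n+m (suc N) (N ℕ.∸ k) ⟩
  (N ℕ.∸ k) ℕ.+ suc N           ≡⟨ ℕ.+-∸-comm (suc N) (ℕ.<⇒≤ k<N) ⟨
  (N ℕ.+ suc N) ℕ.∸ k           ≡⟨ ℤ.∣⊖∣-≤ (ℕ.≤-trans (ℕ.<⇒≤ k<N) (ℕ.m≤m+n N (suc N))) ⟨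
  ∣ k ℤ.⊖ (N ℕ.+ suc N) ∣       ≡⟨ ≡.cong ∣_∣ (ℤ.m-n≡m⊖n k (N ℕ.+ suc N)) ⟨
  ∣ + k ℤ.- + (N ℕ.+ suc N) ∣   ∎
  where open ℕ.≤-Reasoning

∣k-n∣≡∣l-n∣ : ∀ {k l n} → k ℕ.+ l ≡ n ℕ.+ n → ∣ + k ℤ.- + n ∣ ≡ ∣ + l ℤ.- + n ∣
∣k-n∣≡∣l-n∣ {k} {l} {n} e = ≡.trans (≡.cong ∣_∣ (≡.trans
  (solve 3 (λ k l n → k :- n := :- (l :- (k :+ l :- n))) refl (+ k) (+ l) (+ n))
  (≡.cong (λ i → ℤ.- (+ l ℤ.- i)) (≡.trans (≡.cong (λ i → + i ℤ.- + n) e)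
    (solve 1 (λ n → n :+ n :- n := n) refl (+ n))))))
  (ℤ.∣-i∣≡∣i∣ (+ l ℤ.- + n))
  where open ℤ.+-*-Solver

-- Jacobi's triple product in finite form and its limit

module Exponent (A b : ℕ) where
  open ℤ.+-*-Solver

  -- `B` is positive so that exponents grow with ∣ j ∣, while `A` is allowed to be 0, as it is for
  -- f₂³. Successive exponents differ by 2A + sj, which makes q^s the right base for the binomials.
  B s : ℕ
  B = suc b
  s = 2 ℕ.* (B ℕ.+ A)

  exponent : ℤ → ℤ
  exponent j = + A ℤ.* (j ℤ.* ℤ.suc j) ℤ.+ + B ℤ.* (j ℤ.* ℤ.pred j)

  0≤exponent : ∀ j → 0ℤ ℤ.≤ exponent j
  0≤exponent j = ℤ.+-mono-≤ (0≤n*i A (0≤j*[1+j] j)) (0≤n*i B (0≤j*[j-1] j))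

  ∣j∣≤1+∣exponent∣ : ∀ j → ∣ j ∣ ≤ suc ∣ exponent j ∣
  ∣j∣≤1+∣exponent∣ j = ℕ.≤-trans (∣j∣≤1+∣j*[j-1]∣ j) (s≤s bound)
    where
    bound : ∣ j ℤ.* ℤ.pred j ∣ ≤ ∣ exponent j ∣
    bound = let open ℕ.≤-Reasoning in begin
      ∣ j ℤ.* ℤ.pred j ∣
        ≤⟨ ℕ.m≤n*m _ B ⟩
      B ℕ.* ∣ j ℤ.* ℤ.pred j ∣
        ≡⟨ ℤ.abs-* (+ B) (j ℤ.* ℤ.pred j) ⟨
      ∣ + B ℤ.* (j ℤ.* ℤ.pred j) ∣
        ≤⟨ ℕ.m≤n+m _ _ ⟩
      ∣ + A ℤ.* (j ℤ.* ℤ.suc j) ∣ ℕ.+ ∣ + B ℤ.* (j ℤ.* ℤ.pred j) ∣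
        ≡⟨ abs-+ (0≤n*i A (0≤j*[1+j] j)) (0≤n*i B (0≤j*[j-1] j)) ⟨
      ∣ exponent j ∣ ∎

  private
    s-cast : ∀ l → + (s ℕ.* l) ≡ + 2 ℤ.* (+ B ℤ.+ + A) ℤ.* + l
    s-cast l = ≡.trans (ℤ.pos-* s l) (≡.cong (ℤ._* + l) (ℤ.pos-* 2 (B ℕ.+ A)))

  -- The increment 2A + sj of the exponent meets the factor q^(sl) from Pascal's rule, and l = m - j
  -- cancels the dependence on j.
  exponent-suc : ∀ {l m j} → + l ≡ + m ℤ.- j →
    s ℕ.* l ℕ.+ ∣ exponent (ℤ.suc j) ∣ ≡ 2 ℕ.* A ℕ.+ s ℕ.* m ℕ.+ ∣ exponent j ∣
  exponent-suc {l} {m} {j} e = abs-shift (0≤exponent (ℤ.suc j)) (0≤exponent j) (let open ≡.≡-Reasoning in begin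
    + (s ℕ.* l) ℤ.+ exponent (ℤ.suc j)
      ≡⟨ ≡.cong (ℤ._+ exponent (ℤ.suc j)) (≡.trans (s-cast l) (≡.cong (+ 2 ℤ.* (+ B ℤ.+ + A) ℤ.*_) e)) ⟩
    + 2 ℤ.* (+ B ℤ.+ + A) ℤ.* (+ m ℤ.- j) ℤ.+ exponent (ℤ.suc j)
      ≡⟨ solve 4 (λ a b m j →
           con (+ 2) :* (b :+ a) :* (m :- j) :+
           (a :* ((con 1ℤ :+ j) :* (con 1ℤ :+ (con 1ℤ :+ j))) :+
            b :* ((con 1ℤ :+ j) :* (con -1ℤ :+ (con 1ℤ :+ j)))) :=
           con (+ 2) :* a :+ con (+ 2) :* (b :+ a) :* m :+
           (a :* (j :* (con 1ℤ :+ j)) :+ b :* (j :* (con -1ℤ :+ j))))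
           refl (+ A) (+ B) (+ m) j ⟩
    + 2 ℤ.* + A ℤ.+ + 2 ℤ.* (+ B ℤ.+ + A) ℤ.* + m ℤ.+ exponent j
      ≡⟨ ≡.cong (ℤ._+ exponent j) (≡.cong₂ ℤ._+_ (ℤ.pos-* 2 A) (s-cast m)) ⟨
    + (2 ℕ.* A ℕ.+ s ℕ.* m) ℤ.+ exponent j ∎)

  exponent-pred : ∀ {k n j} → + k ≡ + n ℤ.+ j →
    s ℕ.* k ℕ.+ ∣ exponent (ℤ.pred j) ∣ ≡ 2 ℕ.* B ℕ.+ s ℕ.* n ℕ.+ ∣ exponent j ∣
  exponent-pred {k} {n} {j} e = abs-shift (0≤exponent (ℤ.pred j)) (0≤exponent j) (let open ≡.≡-Reasoning in begin
    + (s ℕ.* k) ℤ.+ exponent (ℤ.pred j)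
      ≡⟨ ≡.cong (ℤ._+ exponent (ℤ.pred j)) (≡.trans (s-cast k) (≡.cong (+ 2 ℤ.* (+ B ℤ.+ + A) ℤ.*_) e)) ⟩
    + 2 ℤ.* (+ B ℤ.+ + A) ℤ.* (+ n ℤ.+ j) ℤ.+ exponent (ℤ.pred j)
      ≡⟨ solve 4 (λ a b n j →
           con (+ 2) :* (b :+ a) :* (n :+ j) :+
           (a :* ((con -1ℤ :+ j) :* (con 1ℤ :+ (con -1ℤ :+ j))) :+
            b :* ((con -1ℤ :+ j) :* (con -1ℤ :+ (con -1ℤ :+ j)))) :=
           con (+ 2) :* b :+ con (+ 2) :* (b :+ a) :* n :+
           (a :* (j :* (con 1ℤ :+ j)) :+ b :* (j :* (con -1ℤ :+ j))))
           refl (+ A) (+ B) (+ n) j ⟩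
    + 2 ℤ.* + B ℤ.+ + 2 ℤ.* (+ B ℤ.+ + A) ℤ.* + n ℤ.+ exponent j
      ≡⟨ ≡.cong (ℤ._+ exponent j) (≡.cong₂ ℤ._+_ (ℤ.pos-* 2 B) (s-cast n)) ⟨
    + (2 ℕ.* B ℕ.+ s ℕ.* n) ℤ.+ exponent j ∎)

-- The identity is Σ_j w(j) (-1)^j q^{A j(j+1) + B j(j-1)}, the triple product for
-- w = 1, with Π_{i<m} (1 - q^{2A+si}) Π_{i<n} (1 - q^{2B+si}) in place of the infinite
-- products, where B = 1 + b and s = 2(A + B).
module TripleProduct {c ℓ} (T : TruncatedAlgebra c ℓ) (A b : ℕ) where
  open Ring T
  open ℤ.+-*-Solver using () renaming
    (solve to solveℤ; _:=_ to _⊜_; _:+_ to _⊕_; _:-_ to _⊖_; :-_ to ⊝_; con to κ)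
  open Exponent A b
  open SetoidReasoning setoid

  gaussian : ℤ → Carrier
  gaussian j = ⟦ sgn j ⟧ * pow ∣ exponent j ∣

  theta : (ℤ → ℤ) → ℤ → Carrier
  theta w j = ⟦ w j ⟧ * gaussian j

  gaussian-shift : ∀ {a a′ i j} → sgn i ≡ ℤ.- sgn j →
                   a ℕ.+ ∣ exponent i ∣ ≡ a′ ℕ.+ ∣ exponent j ∣ →
                   pow a * gaussian i ≈ - (pow a′ * gaussian j)
  gaussian-shift {a} {a′} {i} {j} p e = begin
    pow a * (⟦ sgn i ⟧ * pow ∣ exponent i ∣)
      ≈⟨ *-congˡ (*-congʳ (trans (reflexive (≡.cong ⟦_⟧ p)) (-‿homo (sgn j)))) ⟩
    pow a * (- ⟦ sgn j ⟧ * pow ∣ exponent i ∣)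
      ≈⟨ solve 3 (λ x y z → x :* (:- y :* z) := :- (y :* (x :* z))) ≈-refl _ _ _ ⟩
    - (⟦ sgn j ⟧ * (pow a * pow ∣ exponent i ∣))
      ≈⟨ -‿cong (*-congˡ (trans (sym (pow-+ a _)) (trans (reflexive (≡.cong pow e)) (pow-+ a′ _)))) ⟩
    - (⟦ sgn j ⟧ * (pow a′ * pow ∣ exponent j ∣))
      ≈⟨ solve 3 (λ x y z → :- (y :* (x :* z)) := :- (x :* (y :* z))) ≈-refl _ _ _ ⟩
    - (pow a′ * gaussian j) ∎

  open Gaussian (λ l → pow (s ℕ.* l))
    (trans (reflexive (≡.cong pow (ℕ.*-zeroʳ s))) pow-0)
    (λ k l → trans (reflexive (≡.cong pow (ℕ.*-distribˡ-+ s k l))) (pow-+ _ _))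

  -- The finite theta sum over -n ≤ j ≤ M - n.
  finite : (ℤ → ℤ) → ℕ → ℕ → Carrier
  finite w n M = gsum M (λ k _ → theta w (+ k ℤ.- + n))

  finite-+ : ∀ v w n M → finite (λ j → v j ℤ.+ w j) n M ≈ finite v n M + finite w n M
  finite-+ v w n M = trans
    (gsum-cong M λ k l _ → trans (*-congʳ (+-homo _ _)) (distribʳ _ _ _)) (gsum-+ M _ _)

  private
    gsum-step : ∀ M a (f g : ℕ → ℕ → Carrier) →
      gsum M (λ k l → f k l + - (a * g k l)) ≈ gsum M f - a * gsum M g
    gsum-step M a f g = begin
      gsum M (λ k l → f k l + - (a * g k l))
        ≈⟨ gsum-cong M (λ k l _ → +-congˡ (solve 2 (λ a b → :- (a :* b) := :- a :* b) ≈-refl _ _)) ⟩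
      gsum M (λ k l → f k l + - a * g k l)
        ≈⟨ trans (gsum-+ M _ _) (+-congˡ (gsum-*ˡ M _ _)) ⟩
      gsum M f + - a * gsum M g
        ≈⟨ +-congˡ (solve 2 (λ a b → :- a :* b := :- (a :* b)) ≈-refl _ _) ⟩
      gsum M f - a * gsum M g ∎

    weighted : ∀ v {a a′ f g} → a * f ≈ - (a′ * g) → a * (v * f) ≈ - (a′ * (v * g))
    weighted v {a} {a′} {f} {g} e = begin
      a * (v * f)       ≈⟨ solve 3 (λ a v f → a :* (v :* f) := v :* (a :* f)) ≈-refl _ _ _ ⟩
      v * (a * f)       ≈⟨ *-congˡ e ⟩
      v * - (a′ * g)    ≈⟨ solve 3 (λ a v f → v :* :- (a :* f) := :- (a :* (v :* f))) ≈-refl _ _ _ ⟩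
      - (a′ * (v * g))  ∎

  -- The shift costs every term the same factor -q^(2A+sm), so one step of Pascal's rule is a
  -- recurrence for the whole sum. For constant w it splits off the factor 1 - q^(2A+sm).
  finite-sucˡ : ∀ w m n → finite w n (suc (m ℕ.+ n)) ≈
    finite w n (m ℕ.+ n) - pow (2 ℕ.* A ℕ.+ s ℕ.* m) * finite (w ∘ ℤ.suc) n (m ℕ.+ n)
  finite-sucˡ w m n = begin
    finite w n (suc M)
      ≈⟨ pascalˡ M (λ k _ → theta w (+ k ℤ.- + n)) ⟩
    gsum M (λ k l → pow (s ℕ.* l) * theta w (+ suc k ℤ.- + n) + theta w (+ k ℤ.- + n))
      ≈⟨ gsum-cong M (λ k l e → trans (+-comm _ _) (+-congˡ (step k l e))) ⟩
    gsum M (λ k _ → theta w (+ k ℤ.- + n) + - (pow a * theta (w ∘ ℤ.suc) (+ k ℤ.- + n)))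
      ≈⟨ gsum-step M _ _ _ ⟩
    finite w n M - pow a * finite (w ∘ ℤ.suc) n M ∎
    where
    M = m ℕ.+ n
    a = 2 ℕ.* A ℕ.+ s ℕ.* m
    rest : ∀ k l → k ℕ.+ l ≡ M → + l ≡ + m ℤ.- (+ k ℤ.- + n)
    rest k l e = ≡.trans (solveℤ 2 (λ k l → l ⊜ k ⊕ l ⊖ k) refl (+ k) (+ l))
      (≡.trans (≡.cong (λ i → + i ℤ.- + k) e)
        (solveℤ 3 (λ m n k → m ⊕ n ⊖ k ⊜ m ⊖ (k ⊖ n)) refl (+ m) (+ n) (+ k)))
    step : ∀ k l → k ℕ.+ l ≡ M → pow (s ℕ.* l) * theta w (+ suc k ℤ.- + n) ≈
           - (pow a * theta (w ∘ ℤ.suc) (+ k ℤ.- + n))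
    step k l e = begin
      pow (s ℕ.* l) * theta w (+ suc k ℤ.- + n)
        ≈⟨ *-congˡ (reflexive (≡.cong (theta w) (ℤ.+-assoc 1ℤ (+ k) (ℤ.- + n)))) ⟩
      pow (s ℕ.* l) * theta w (ℤ.suc (+ k ℤ.- + n))
        ≈⟨ weighted _ (gaussian-shift {i = ℤ.suc (+ k ℤ.- + n)} {+ k ℤ.- + n}
             (sgn-suc (+ k ℤ.- + n)) (exponent-suc {l} {m} {+ k ℤ.- + n} (rest k l e))) ⟩
      - (pow a * theta (w ∘ ℤ.suc) (+ k ℤ.- + n)) ∎

  -- The mirror image, through the other Pascal rule: here the range grows at its lower end.
  finite-sucʳ : ∀ w n M → finite w (suc n) (suc M) ≈
    finite w n M - pow (2 ℕ.* B ℕ.+ s ℕ.* n) * finite (w ∘ ℤ.pred) n M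
  finite-sucʳ w n M = begin
    finite w (suc n) (suc M)
      ≈⟨ pascalʳ M (λ k _ → theta w (+ k ℤ.- + suc n)) ⟩
    gsum M (λ k l → theta w (+ suc k ℤ.- + suc n) + pow (s ℕ.* k) * theta w (+ k ℤ.- + suc n))
      ≈⟨ gsum-cong M (λ k l _ → +-cong (reflexive (≡.cong (theta w) (cancel k))) (step k)) ⟩
    gsum M (λ k _ → theta w (+ k ℤ.- + n) + - (pow a * theta (w ∘ ℤ.pred) (+ k ℤ.- + n)))
      ≈⟨ gsum-step M _ _ _ ⟩
    finite w n M - pow a * finite (w ∘ ℤ.pred) n M ∎
    where
    a = 2 ℕ.* B ℕ.+ s ℕ.* n
    cancel : ∀ k → + suc k ℤ.- + suc n ≡ + k ℤ.- + n
    cancel k = solveℤ 2 (λ k n → κ 1ℤ ⊕ k ⊖ (κ 1ℤ ⊕ n) ⊜ k ⊖ n) refl (+ k) (+ n)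
    step : ∀ k → pow (s ℕ.* k) * theta w (+ k ℤ.- + suc n) ≈
           - (pow a * theta (w ∘ ℤ.pred) (+ k ℤ.- + n))
    step k = begin
      pow (s ℕ.* k) * theta w (+ k ℤ.- + suc n)
        ≈⟨ *-congˡ (reflexive (≡.cong (theta w)
             (solveℤ 2 (λ k n → k ⊖ (κ 1ℤ ⊕ n) ⊜ κ -1ℤ ⊕ (k ⊖ n)) refl (+ k) (+ n)))) ⟩
      pow (s ℕ.* k) * theta w (ℤ.pred (+ k ℤ.- + n))
        ≈⟨ weighted _ (gaussian-shift {i = ℤ.pred (+ k ℤ.- + n)} {+ k ℤ.- + n}
             (sgn-pred (+ k ℤ.- + n)) (exponent-pred {k} {n} {+ k ℤ.- + n}
             (solveℤ 2 (λ k n → k ⊜ n ⊕ (k ⊖ n)) refl (+ k) (+ n)))) ⟩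
      - (pow a * theta (w ∘ ℤ.pred) (+ k ℤ.- + n)) ∎

  productˡ productʳ : ℕ → Carrier
  productˡ = prod (λ i → 1-pow (2 ℕ.* A ℕ.+ s ℕ.* i))
  productʳ = prod (λ i → 1-pow (2 ℕ.* B ℕ.+ s ℕ.* i))

  1-pow-* : ∀ e y → y - pow e * y ≈ 1-pow e * y
  1-pow-* e y = sym (trans (distribʳ _ _ _) (+-cong (*-identityˡ y)
    (solve 2 (λ a b → :- a :* b := :- (a :* b)) ≈-refl (pow e) y)))

  finite-product : ∀ m n → finite (λ _ → 1ℤ) n (m ℕ.+ n) ≈ productˡ m * productʳ n
  finite-product zero zero = begin
    ⟦ 1ℤ ⟧ * (⟦ 1ℤ ⟧ * pow ∣ exponent 0ℤ ∣) * 1#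
      ≈⟨ *-congʳ (*-cong 1-homo (*-cong 1-homo (trans (reflexive (≡.cong pow exponent-0)) pow-0))) ⟩
    1# * (1# * 1#) * 1#    ≈⟨ *-congʳ (*-identityˡ _) ⟩
    1# * 1# * 1#           ≈⟨ *-congʳ (*-identityˡ _) ⟩
    1# * 1#                ∎
    where
    exponent-0 : ∣ exponent 0ℤ ∣ ≡ 0
    exponent-0 = ≡.cong ∣_∣ (≡.cong₂ ℤ._+_ (ℤ.*-zeroʳ (+ A)) (ℤ.*-zeroʳ (+ B)))
  finite-product zero (suc n) = begin
    finite (λ _ → 1ℤ) (suc n) (suc n)
      ≈⟨ trans (finite-sucʳ _ n n) (1-pow-* _ _) ⟩
    1-pow (2 ℕ.* B ℕ.+ s ℕ.* n) * finite (λ _ → 1ℤ) n n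
      ≈⟨ *-congˡ (trans (finite-product zero n) (*-identityˡ _)) ⟩
    productʳ (suc n)
      ≈⟨ *-identityˡ _ ⟨
    productˡ 0 * productʳ (suc n) ∎
  finite-product (suc m) n = begin
    finite (λ _ → 1ℤ) n (suc m ℕ.+ n)
      ≈⟨ trans (finite-sucˡ _ m n) (1-pow-* _ _) ⟩
    1-pow (2 ℕ.* A ℕ.+ s ℕ.* m) * finite (λ _ → 1ℤ) n (m ℕ.+ n)
      ≈⟨ trans (*-congˡ (finite-product m n)) (sym (*-assoc _ _ _)) ⟩
    productˡ (suc m) * productʳ n ∎

  theta-supported : ∀ w → Supported (suc order) (theta w)
  theta-supported w j p = trans (*-congˡ (trans (*-congˡ
    (pow-≥ _ (ℕ.≤-pred (ℕ.≤-trans p (∣j∣≤1+∣exponent∣ j))))) (zeroʳ _))) (zeroʳ _)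

  private
    factorial-stable : ∀ {n} → order ≤ n → factorial n ≈ φ∞ s
    factorial-stable = φ-stable s

    -- When k and l reach the order, the factorials of k, l and k + l all equal the unit `φ∞ s`.
    bin-limit : ∀ k l → order ≤ k → order ≤ l → φ∞ s * bin k l ≈ 1#
    bin-limit k l p r = unit-cancel (φ-unit s order) (begin
      φ∞ s * (φ∞ s * bin k l)
        ≈⟨ solve 2 (λ a b → a :* (a :* b) := b :* (a :* a)) ≈-refl _ _ ⟩
      bin k l * (φ∞ s * φ∞ s)
        ≈⟨ *-congˡ (*-cong (factorial-stable p) (factorial-stable r)) ⟨
      bin k l * (factorial k * factorial l)
        ≈⟨ bin-factorial k l ⟩
      factorial (k ℕ.+ l)
        ≈⟨ factorial-stable (ℕ.≤-trans p (ℕ.m≤m+n k l)) ⟩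
      φ∞ s
        ≈⟨ *-identityʳ _ ⟨
      φ∞ s * 1# ∎)

  theta-limit : ∀ w {v} → (∀ n → order < n → finite w n (n ℕ.+ n) ≈ v) → theta w ⇓ φ∞ s * v
  theta-limit w {v} e = ⇓-cong (λ _ → ≈-refl) value (supported⇒⇓ (theta-supported w))
    where
    -- With this n, either k and l are both at least `order` and the binomial is the inverse of
    -- `φ∞ s`, or ∣ k - n ∣ exceeds `order` and the theta term is 0.
    n = order ℕ.+ suc order
    M = n ℕ.+ n
    termwise : ∀ k l → k ℕ.+ l ≡ M →
               theta w (k ℤ.⊖ n) ≈ φ∞ s * (theta w (+ k ℤ.- + n) * bin k l)
    termwise k l r = trans (reflexive (≡.cong (theta w) (≡.sym (ℤ.m-n≡m⊖n k n)))) (go (order ℕ.≤? k) (order ℕ.≤? l))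
      where
      t = theta w (+ k ℤ.- + n)
      outside : order < ∣ + k ℤ.- + n ∣ → t ≈ φ∞ s * (t * bin k l)
      outside p = trans t≈0 (sym (trans (*-congˡ (trans (*-congʳ t≈0) (zeroˡ _))) (zeroʳ _)))
        where t≈0 = theta-supported w (+ k ℤ.- + n) p
      go : _ → _ → t ≈ φ∞ s * (t * bin k l)
      go (yes p) (yes r) = sym (trans
        (solve 3 (λ a b c → a :* (b :* c) := b :* (a :* c)) ≈-refl _ _ _)
        (trans (*-congˡ (bin-limit k l p r)) (*-identityʳ _)))
      go (no p) _        = outside (N<∣k-[2N+1]∣ (ℕ.≰⇒> p))
      go _      (no p)   = outside (≡.subst (order <_) (≡.sym (∣k-n∣≡∣l-n∣ {k} {l} {n} r)) (N<∣k-[2N+1]∣ (ℕ.≰⇒> p)))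
    value : bsum (suc order) (suc order) (theta w) ≈ φ∞ s * v
    value = begin
      bsum (suc order) (suc order) (theta w)
        ≈⟨ bsum-supported (theta-supported w) n≥ (ℕ.m≤n⇒m≤1+n n≥) ⟨
      bsum n (suc n) (theta w)
        ≈⟨ asum-bsum n n (theta w) ⟨
      asum M (λ k _ → theta w (k ℤ.⊖ n))
        ≈⟨ asum-cong M termwise ⟩
      asum M (λ k l → φ∞ s * (theta w (+ k ℤ.- + n) * bin k l))
        ≈⟨ asum-*ˡ M _ _ ⟩
      φ∞ s * finite w n M
        ≈⟨ *-congˡ (e n n≥) ⟩
      φ∞ s * v ∎
      where
      n≥ : suc order ≤ n
      n≥ = ℕ.m≤n+m (suc order) order

-- Theta series of f₂, f₄, f₂²/f₄ and f₂³

module ThetaProducts {c ℓ} (T : TruncatedAlgebra c ℓ) where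
  open Ring T
  open SetoidReasoning setoid
  open ℕ.+-*-Solver using () renaming
    (solve to solveℕ; _:=_ to _⊜_; _:+_ to _⊕_; _:*_ to _⊗_; con to κ)

  opaque
    -- Integer exponents let the ring solver treat the quadratic forms; the absolute value loses
    -- nothing because the exponents that occur are nonnegative.
    monomial : ℤ → ℤ → Carrier
    monomial w e = ⟦ w ⟧ * pow ∣ e ∣

    monomial-def : ∀ w e → ⟦ w ⟧ * pow ∣ e ∣ ≈ monomial w e
    monomial-def w e = ≈-refl

    monomial-+ : ∀ v w e → monomial (v ℤ.+ w) e ≈ monomial v e + monomial w e
    monomial-+ v w e = trans (*-congʳ (+-homo v w)) (distribʳ _ _ _)

    monomial-neg : ∀ w e → monomial (ℤ.- w) e ≈ - monomial w e
    monomial-neg w e = trans (*-congʳ (-‿homo w))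
      (solve 2 (λ a b → :- a :* b := :- (a :* b)) ≈-refl _ _)

    monomial-* : ∀ v w {d e} → 0ℤ ℤ.≤ d → 0ℤ ℤ.≤ e →
                 monomial v d * monomial w e ≈ monomial (v ℤ.* w) (d ℤ.+ e)
    monomial-* v w {d} {e} 0≤d 0≤e = begin
      ⟦ v ⟧ * pow ∣ d ∣ * (⟦ w ⟧ * pow ∣ e ∣)
        ≈⟨ solve 4 (λ a b c d → a :* b :* (c :* d) := (a :* c) :* (b :* d)) ≈-refl _ _ _ _ ⟩
      ⟦ v ⟧ * ⟦ w ⟧ * (pow ∣ d ∣ * pow ∣ e ∣)
        ≈⟨ *-cong (*-homo v w) (trans (reflexive (≡.cong pow (abs-+ 0≤d 0≤e))) (pow-+ _ _)) ⟨
      monomial (v ℤ.* w) (d ℤ.+ e) ∎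

    monomial-scale : ∀ u v e → ⟦ u ⟧ * monomial v e ≈ monomial (u ℤ.* v) e
    monomial-scale u v e = trans (sym (*-assoc _ _ _)) (*-congʳ (sym (*-homo u v)))

    monomial-≥ : ∀ w {e} → order ≤ ∣ e ∣ → monomial w e ≈ 0#
    monomial-≥ w p = trans (*-congˡ (pow-≥ _ p)) (zeroʳ _)

  monomial-cong : ∀ {v w d e} → v ≡ w → d ≡ e → monomial v d ≈ monomial w e
  monomial-cong refl refl = ≈-refl

  monomial-supported : ∀ {w e : ℤ → ℤ} → (∀ j → ∣ j ∣ ≤ suc ∣ e j ∣) →
                       Supported (suc order) (λ j → monomial (w j) (e j))
  monomial-supported bound j p = monomial-≥ _ (ℕ.≤-pred (ℕ.≤-trans p (bound j)))

  φ∞2 φ∞4 : Carrier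
  φ∞2 = φ∞ 2
  φ∞4 = φ∞ 4

  private
    prod-halves : ∀ {f g h : ℕ → ℕ} →
      (∀ n → f n ≡ h (n ℕ.* 2)) → (∀ n → g n ≡ h (1 ℕ.+ n ℕ.* 2)) →
      ∀ n → prod (1-pow ∘ f) n * prod (1-pow ∘ g) n ≈ prod (1-pow ∘ h) (n ℕ.* 2)
    prod-halves f≡ g≡ zero    = *-identityˡ _
    prod-halves {f} {g} {h} f≡ g≡ (suc n) = begin
      1-pow (f n) * prod (1-pow ∘ f) n * (1-pow (g n) * prod (1-pow ∘ g) n)
        ≈⟨ solve 4 (λ a b c d → a :* b :* (c :* d) := c :* (a :* (b :* d))) ≈-refl _ _ _ _ ⟩
      1-pow (g n) * (1-pow (f n) * (prod (1-pow ∘ f) n * prod (1-pow ∘ g) n))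
        ≈⟨ *-cong (reflexive (≡.cong 1-pow (g≡ n)))
             (*-cong (reflexive (≡.cong 1-pow (f≡ n))) (prod-halves f≡ g≡ n)) ⟩
      prod (1-pow ∘ h) (suc n ℕ.* 2) ∎

    prod-thirds : ∀ {e f g h : ℕ → ℕ} →
      (∀ n → e n ≡ h (2 ℕ.+ n ℕ.* 3)) → (∀ n → f n ≡ h (n ℕ.* 3)) →
      (∀ n → g n ≡ h (1 ℕ.+ n ℕ.* 3)) → ∀ n →
      prod (1-pow ∘ e) n * (prod (1-pow ∘ f) n * prod (1-pow ∘ g) n) ≈ prod (1-pow ∘ h) (n ℕ.* 3)
    prod-thirds e≡ f≡ g≡ zero    = trans (*-identityˡ _) (*-identityˡ _)
    prod-thirds {e} {f} {g} {h} e≡ f≡ g≡ (suc n) = begin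
      1-pow (e n) * prod (1-pow ∘ e) n *
        (1-pow (f n) * prod (1-pow ∘ f) n * (1-pow (g n) * prod (1-pow ∘ g) n))
        ≈⟨ solve 6 (λ a b c d e f → a :* b :* (c :* d :* (e :* f)) :=
             a :* (e :* (c :* (b :* (d :* f))))) ≈-refl _ _ _ _ _ _ ⟩
      1-pow (e n) * (1-pow (g n) * (1-pow (f n) *
        (prod (1-pow ∘ e) n * (prod (1-pow ∘ f) n * prod (1-pow ∘ g) n))))
        ≈⟨ *-cong (reflexive (≡.cong 1-pow (e≡ n))) (*-cong (reflexive (≡.cong 1-pow (g≡ n)))
             (*-cong (reflexive (≡.cong 1-pow (f≡ n))) (prod-thirds e≡ f≡ g≡ n))) ⟩
      prod (1-pow ∘ h) (suc n ℕ.* 3) ∎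

    grows : ∀ a s .{{_ : ℕ.NonZero s}} i → i ≤ a ℕ.+ s ℕ.* i
    grows a s i = ℕ.≤-trans (ℕ.m≤n*m i s) (ℕ.m≤n+m _ a)

  -- With A = k and B = 2k the three products of the triple product interlace.
  module Pentagonal (k-1 : ℕ) where
    private
      k = suc k-1
      -- Here b is 2k - 1, written so that `B` reduces to k + k.
      module J = TripleProduct T k (k-1 ℕ.+ suc k-1)
      open Exponent k (k-1 ℕ.+ suc k-1)

    pentagonal : ℤ → Carrier
    pentagonal j = monomial (sgn j) (+ k ℤ.* (j ℤ.* (+ 3 ℤ.* j ℤ.- 1ℤ)))

    private
      exponent-pentagonal : ∀ j → exponent j ≡ + k ℤ.* (j ℤ.* (+ 3 ℤ.* j ℤ.- 1ℤ))
      exponent-pentagonal j = S.solve 2 (λ k j →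
        k S.:* (j S.:* (S.con 1ℤ S.:+ j)) S.:+ (k S.:+ k) S.:* (j S.:* (S.con -1ℤ S.:+ j)) S.:=
        k S.:* (j S.:* (S.con (+ 3) S.:* j S.:- S.con 1ℤ))) refl (+ k) j
        where module S = ℤ.+-*-Solver

    -- Euler's theorem in base q^(2k), as k j(3j - 1) is 2k times a generalised pentagonal number.
    -- The three products run over the multiples of 2k congruent to 2k, 4k and 0 modulo 6k.
    pentagonal⇓ : pentagonal ⇓ φ∞ (2 ℕ.* k)
    pentagonal⇓ = ⇓-cong
      (λ j → trans (*-congʳ 1-homo) (trans (*-identityˡ _)
        (trans (monomial-def _ _) (monomial-cong refl (exponent-pentagonal j)))))
      (trans (prod-thirds third₀ third₁ third₂ order) (φ-stable (2 ℕ.* k) (ℕ.m≤m*n order 3)))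
      (J.theta-limit (λ _ → 1ℤ) λ n p → trans (J.finite-product n n)
        (*-cong (prod-stable (grows (2 ℕ.* k) s) (ℕ.<⇒≤ p)) (prod-stable (grows (2 ℕ.* B) s) (ℕ.<⇒≤ p))))
      where
      third₀ : ∀ n → s ℕ.* suc n ≡ 2 ℕ.* k ℕ.* suc (2 ℕ.+ n ℕ.* 3)
      third₀ n = solveℕ 2 (λ k n → κ 2 ⊗ (k ⊕ k ⊕ k) ⊗ (κ 1 ⊕ n) ⊜
        κ 2 ⊗ k ⊗ (κ 3 ⊕ n ⊗ κ 3)) refl k n
      third₁ : ∀ n → 2 ℕ.* k ℕ.+ s ℕ.* n ≡ 2 ℕ.* k ℕ.* suc (n ℕ.* 3)
      third₁ n = solveℕ 2 (λ k n → κ 2 ⊗ k ⊕ κ 2 ⊗ (k ⊕ k ⊕ k) ⊗ n ⊜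
        κ 2 ⊗ k ⊗ (κ 1 ⊕ n ⊗ κ 3)) refl k n
      third₂ : ∀ n → 2 ℕ.* B ℕ.+ s ℕ.* n ≡ 2 ℕ.* k ℕ.* suc (1 ℕ.+ n ℕ.* 3)
      third₂ n = solveℕ 2 (λ k n → κ 2 ⊗ (k ⊕ k) ⊕ κ 2 ⊗ (k ⊕ k ⊕ k) ⊗ n ⊜
        κ 2 ⊗ k ⊗ (κ 2 ⊕ n ⊗ κ 3)) refl k n

  private
    module G = TripleProduct T 1 0

  square : ℤ → Carrier
  square j = monomial (sgn j) (+ 2 ℤ.* (j ℤ.* j))

  -- The series g as the product f₄ (q²; q⁴)², which is the triple product for A = B = 1; `φ∞4*γ`
  -- identifies it with f₂²/f₄ without dividing.
  γ : Carrier
  γ = φ∞4 * (G.productˡ order * G.productʳ order)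

  square⇓ : square ⇓ γ
  square⇓ = ⇓-cong
    (λ j → trans (*-congʳ 1-homo) (trans (*-identityˡ _)
      (trans (monomial-def _ _) (monomial-cong refl (exponent-square j)))))
    ≈-refl
    (G.theta-limit (λ _ → 1ℤ) λ n p → trans (G.finite-product n n)
      (*-cong (prod-stable (grows 2 4) (ℕ.<⇒≤ p)) (prod-stable (grows 2 4) (ℕ.<⇒≤ p))))
    where
    exponent-square : ∀ j → Exponent.exponent 1 0 j ≡ + 2 ℤ.* (j ℤ.* j)
    exponent-square = S.solve 1 (λ j →
      S.con 1ℤ S.:* (j S.:* (S.con 1ℤ S.:+ j)) S.:+ S.con 1ℤ S.:* (j S.:* (S.con -1ℤ S.:+ j)) S.:=
      S.con (+ 2) S.:* (j S.:* j)) refl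
      where module S = ℤ.+-*-Solver

  φ∞4*γ : φ∞4 * γ ≈ φ∞2 * φ∞2
  φ∞4*γ = begin
    φ∞4 * (φ∞4 * (O * O))     ≈⟨ solve 2 (λ f o → f :* (f :* (o :* o)) := o :* f :* (o :* f)) ≈-refl _ _ ⟩
    O * φ∞4 * (O * φ∞4)       ≈⟨ *-cong O*φ∞4 O*φ∞4 ⟩
    φ∞2 * φ∞2                 ∎
    where
    -- The exponents in `O` are the odd multiples of 2, those in `φ∞4` the even ones. Both products
    -- in `γ` equal `O`, since A = B.
    O = G.productˡ order
    O*φ∞4 : O * φ∞4 ≈ φ∞2
    O*φ∞4 = trans (prod-halves even odd order) (φ-stable 2 (ℕ.m≤m*n order 2))
      where
      even : ∀ n → 2 ℕ.+ 4 ℕ.* n ≡ 2 ℕ.* suc (n ℕ.* 2)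
      even = solveℕ 1 (λ n → κ 2 ⊕ κ 4 ⊗ n ⊜ κ 2 ⊗ (κ 1 ⊕ n ⊗ κ 2)) refl
      odd : ∀ n → 4 ℕ.* suc n ≡ 2 ℕ.* suc (1 ℕ.+ n ℕ.* 2)
      odd = solveℕ 1 (λ n → κ 4 ⊗ (κ 1 ⊕ n) ⊜ κ 2 ⊗ (κ 2 ⊕ n ⊗ κ 2)) refl

  private
    module C = TripleProduct T 0 0

  -- Bilateral form of Jacobi's series: the terms at j and 1 - j add up to (-1)^j (2j - 1)
  -- q^{j(j-1)}, and summing these over j ≥ 1 gives -f₂³.
  cube : ℤ → Carrier
  cube j = monomial (j ℤ.* sgn j) (j ℤ.* ℤ.pred j)

  -- The factor 1 - q^0 kills the unweighted sums, so multiplying by 1 - a q^{sm} acts on the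
  -- sum weighted by j as on a product.
  cube⇓ : cube ⇓ - (φ∞2 * φ∞2 * φ∞2)
  cube⇓ = ⇓-cong
    (λ j → trans (*-congˡ (monomial-def _ _)) (trans (monomial-scale j (sgn j) _)
      (monomial-cong refl (exponent-cube j))))
    (solve 1 (λ f → f :* :- (f :* f) := :- (f :* f :* f)) ≈-refl φ∞2)
    (C.theta-limit (λ j → j) λ where
      (suc m) (s≤s p) → trans (finite-id m (suc m))
        (-‿cong (*-cong (φ-stable 2 p) (trans (prod-cong shift (suc m)) (φ-stable 2 (ℕ.m≤n⇒m≤1+n p))))))
    where
    exponent-cube : ∀ j → Exponent.exponent 0 0 j ≡ j ℤ.* ℤ.pred j
    exponent-cube j = ≡.trans (≡.cong₂ ℤ._+_ (ℤ.*-zeroˡ (j ℤ.* ℤ.suc j)) (ℤ.*-identityˡ (j ℤ.* ℤ.pred j)))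
      (ℤ.+-identityˡ (j ℤ.* ℤ.pred j))
    shift : ∀ i → 1-pow (2 ℕ.+ 2 ℕ.* i) ≈ 1-pow (2 ℕ.* suc i)
    shift i = reflexive (≡.cong 1-pow (≡.sym (ℕ.*-suc 2 i)))
    productˡ≈0 : ∀ m → C.productˡ (suc m) ≈ 0#
    productˡ≈0 zero    = trans (*-congʳ (trans (+-congˡ (-‿cong pow-0)) (-‿inverseʳ 1#))) (zeroˡ _)
    productˡ≈0 (suc m) = trans (*-congˡ (productˡ≈0 m)) (zeroʳ _)
    finite-1≈0 : ∀ m n → C.finite (λ _ → 1ℤ) n (suc m ℕ.+ n) ≈ 0#
    finite-1≈0 m n = trans (C.finite-product (suc m) n) (trans (*-congʳ (productˡ≈0 m)) (zeroˡ _))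
    finite-id : ∀ m n → C.finite (λ j → j) n (suc m ℕ.+ n) ≈ - (φ 2 m * C.productʳ n)
    -- At m = 0 the shift factor is q^0 = 1, so the weighted sums cancel and leave the unweighted
    -- sum, which does not contain the zero factor yet. This plays the part of the derivative of the
    -- triple product at its zero.
    finite-id zero n = begin
      C.finite (λ j → j) n (suc n)
        ≈⟨ C.finite-sucˡ (λ j → j) 0 n ⟩
      X - pow 0 * C.finite ℤ.suc n n
        ≈⟨ +-congˡ (-‿cong (*-cong pow-0 (C.finite-+ (λ _ → 1ℤ) (λ j → j) n n))) ⟩
      X - 1# * (C.finite (λ _ → 1ℤ) n n + X)
        ≈⟨ solve 3 (λ o f x → x :- o :* (f :+ x) := (x :- o :* x) :- o :* f) ≈-refl _ _ _ ⟩
      (X - 1# * X) - 1# * C.finite (λ _ → 1ℤ) n n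
        ≈⟨ +-cong (trans (+-congˡ (-‿cong (*-identityˡ X))) (-‿inverseʳ X))
                  (-‿cong (trans (*-identityˡ _) (C.finite-product 0 n))) ⟩
      0# - 1# * C.productʳ n
        ≈⟨ +-identityˡ _ ⟩
      - (1# * C.productʳ n) ∎
      where X = C.finite (λ j → j) n n
    finite-id (suc m) n = begin
      C.finite (λ j → j) n (suc M)
        ≈⟨ C.finite-sucˡ (λ j → j) (suc m) n ⟩
      X - pow (2 ℕ.* suc m) * C.finite ℤ.suc n M
        ≈⟨ +-congˡ (-‿cong (*-congˡ (C.finite-+ (λ _ → 1ℤ) (λ j → j) n M))) ⟩
      X - pow (2 ℕ.* suc m) * (C.finite (λ _ → 1ℤ) n M + X)
        ≈⟨ +-congˡ (-‿cong (*-congˡ (trans (+-congʳ (finite-1≈0 m n)) (+-identityˡ X)))) ⟩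
      X - pow (2 ℕ.* suc m) * X
        ≈⟨ trans (C.1-pow-* _ _) (*-congˡ (finite-id m n)) ⟩
      1-pow (2 ℕ.* suc m) * - (φ 2 m * C.productʳ n)
        ≈⟨ solve 3 (λ a b c → a :* :- (b :* c) := :- (a :* b :* c)) ≈-refl _ _ _ ⟩
      - (φ 2 (suc m) * C.productʳ n) ∎
      where
      M = suc m ℕ.+ n
      X = C.finite (λ j → j) n M

-- The series ρ from the product of f₂³ and f₂²/f₄

n≤n*n : ∀ n → n ≤ n ℕ.* n
n≤n*n zero    = z≤n
n≤n*n (suc n) = ℕ.m≤m*n (suc n) (suc n)

0≤j*[3j-1] : ∀ j → 0ℤ ℤ.≤ j ℤ.* (+ 3 ℤ.* j ℤ.- 1ℤ)
0≤j*[3j-1] j = ≡.subst (0ℤ ℤ.≤_)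
  (solve 1 (λ j → j :* (con -1ℤ :+ j) :+ con (+ 2) :* (j :* j) := j :* (con (+ 3) :* j :- con 1ℤ)) refl j)
  (ℤ.+-mono-≤ (0≤j*[j-1] j) (0≤n*i 2 (0≤j*j j)))
  where open ℤ.+-*-Solver

0≤j*[3j+1] : ∀ j → 0ℤ ℤ.≤ j ℤ.* (+ 3 ℤ.* j ℤ.+ 1ℤ)
0≤j*[3j+1] j = ≡.subst (0ℤ ℤ.≤_)
  (solve 1 (λ j → :- j :* (con (+ 3) :* :- j :- con 1ℤ) := j :* (con (+ 3) :* j :+ con 1ℤ)) refl j)
  (0≤j*[3j-1] (ℤ.- j))
  where open ℤ.+-*-Solver

∣j∣≤1+∣j*[3j-1]∣ : ∀ j → ∣ j ∣ ≤ suc ∣ j ℤ.* (+ 3 ℤ.* j ℤ.- 1ℤ) ∣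
∣j∣≤1+∣j*[3j-1]∣ j = ℕ.≤-trans (∣j∣≤1+∣j*[j-1]∣ j) (s≤s (ℕ.≤-trans (ℕ.m≤m+n _ _)
  (ℕ.≤-reflexive (≡.trans (≡.sym (abs-+ (0≤j*[j-1] j) (0≤n*i 2 (0≤j*j j))))
    (≡.cong ∣_∣ (solve 1 (λ j → j :* (con -1ℤ :+ j) :+ con (+ 2) :* (j :* j) :=
      j :* (con (+ 3) :* j :- con 1ℤ)) refl j))))))
  where open ℤ.+-*-Solver

∣j∣≤1+∣j*[3j+1]∣ : ∀ j → ∣ j ∣ ≤ suc ∣ j ℤ.* (+ 3 ℤ.* j ℤ.+ 1ℤ) ∣
∣j∣≤1+∣j*[3j+1]∣ j = ≡.subst₂ (λ m i → m ≤ suc ∣ i ∣) (ℤ.∣-i∣≡∣i∣ j)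
  (solve 1 (λ j → :- j :* (con (+ 3) :* :- j :- con 1ℤ) := j :* (con (+ 3) :* j :+ con 1ℤ)) refl j)
  (∣j∣≤1+∣j*[3j-1]∣ (ℤ.- j))
  where open ℤ.+-*-Solver

-- The exponent m(m - 1) + 2l² of the product of the theta series of the cube and of the
-- square, in terms of N = m + 2l; the residue of N modulo 3 then separates the variables.
module Shear where
  open ℤ.+-*-Solver

  shear : ℤ → ℤ → ℤ
  shear N l = (N ℤ.- + 2 ℤ.* l) ℤ.* ℤ.pred (N ℤ.- + 2 ℤ.* l) ℤ.+ + 2 ℤ.* (l ℤ.* l)

  shear-column : ∀ l m → shear (+ 2 ℤ.* l ℤ.+ m) l ≡ m ℤ.* ℤ.pred m ℤ.+ + 2 ℤ.* (l ℤ.* l)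
  shear-column = solve 2 (λ l m → let i = con (+ 2) :* l :+ m :- con (+ 2) :* l in
    i :* (con -1ℤ :+ i) :+ con (+ 2) :* (l :* l) :=
    m :* (con -1ℤ :+ m) :+ con (+ 2) :* (l :* l)) refl

  -- In l the exponent has leading part 6l² - 4Nl, centred near N/3; moving l by j therefore removes
  -- the mixed term.
  shear₀ : ∀ j l → shear (j ℤ.* + 3) (j ℤ.+ l) ≡
    j ℤ.* (+ 3 ℤ.* j ℤ.- 1ℤ) ℤ.+ + 2 ℤ.* (ℤ.- l ℤ.* (+ 3 ℤ.* ℤ.- l ℤ.- 1ℤ))
  shear₀ = solve 2 (λ j l → let i = j :* con (+ 3) :- con (+ 2) :* (j :+ l) in
    i :* (con -1ℤ :+ i) :+ con (+ 2) :* ((j :+ l) :* (j :+ l)) :=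
    j :* (con (+ 3) :* j :- con 1ℤ) :+ con (+ 2) :* (:- l :* (con (+ 3) :* :- l :- con 1ℤ))) refl

  shear₁ : ∀ j l → shear (1ℤ ℤ.+ j ℤ.* + 3) (j ℤ.+ l) ≡
    j ℤ.* (+ 3 ℤ.* j ℤ.+ 1ℤ) ℤ.+ + 2 ℤ.* (l ℤ.* (+ 3 ℤ.* l ℤ.- 1ℤ))
  shear₁ = solve 2 (λ j l → let i = con 1ℤ :+ j :* con (+ 3) :- con (+ 2) :* (j :+ l) in
    i :* (con -1ℤ :+ i) :+ con (+ 2) :* ((j :+ l) :* (j :+ l)) :=
    j :* (con (+ 3) :* j :+ con 1ℤ) :+ con (+ 2) :* (l :* (con (+ 3) :* l :- con 1ℤ))) refl

  -- For N = 3j + 2 the centre is j + 1/2, so reflection in it preserves the exponent and changes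
  -- the parity of the summation index; this makes the row cancel.
  shear₂ : ∀ j l → shear (+ 2 ℤ.+ j ℤ.* + 3) (j ℤ.+ ℤ.suc (-1ℤ ℤ.- l)) ≡
                   shear (+ 2 ℤ.+ j ℤ.* + 3) (j ℤ.+ ℤ.suc l)
  shear₂ = solve 2 (λ j l →
    let N = con (+ 2) :+ j :* con (+ 3)
        x = j :+ (con 1ℤ :+ (con -1ℤ :- l))
        y = j :+ (con 1ℤ :+ l)
        i = N :- con (+ 2) :* x
        k = N :- con (+ 2) :* y in
    i :* (con -1ℤ :+ i) :+ con (+ 2) :* (x :* x) := k :* (con -1ℤ :+ k) :+ con (+ 2) :* (y :* y)) refl

  private
    square-part : ∀ l → ∣ + 2 ℤ.* l ∣ ≤ ∣ + 2 ℤ.* (l ℤ.* l) ∣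
    square-part l = begin
      ∣ + 2 ℤ.* l ∣          ≡⟨ ℤ.abs-* (+ 2) l ⟩
      2 ℕ.* ∣ l ∣            ≤⟨ ℕ.*-monoʳ-≤ 2 (n≤n*n ∣ l ∣) ⟩
      2 ℕ.* (∣ l ∣ ℕ.* ∣ l ∣) ≡⟨ ≡.cong (2 ℕ.*_) (ℤ.abs-* l l) ⟨
      2 ℕ.* ∣ l ℤ.* l ∣      ≡⟨ ℤ.abs-* (+ 2) (l ℤ.* l) ⟨
      ∣ + 2 ℤ.* (l ℤ.* l) ∣  ∎
      where open ℕ.≤-Reasoning

    shear-split : ∀ N l → ∣ shear N l ∣ ≡
      ∣ (N ℤ.- + 2 ℤ.* l) ℤ.* ℤ.pred (N ℤ.- + 2 ℤ.* l) ∣ ℕ.+ ∣ + 2 ℤ.* (l ℤ.* l) ∣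
    shear-split N l = abs-+ (0≤j*[j-1] (N ℤ.- + 2 ℤ.* l)) (0≤n*i 2 (0≤j*j l))

  ∣l∣≤∣shear∣ : ∀ N l → ∣ l ∣ ≤ ∣ shear N l ∣
  ∣l∣≤∣shear∣ N l = begin
    ∣ l ∣                  ≤⟨ ℕ.m≤n*m ∣ l ∣ 2 ⟩
    2 ℕ.* ∣ l ∣            ≡⟨ ℤ.abs-* (+ 2) l ⟨
    ∣ + 2 ℤ.* l ∣          ≤⟨ square-part l ⟩
    ∣ + 2 ℤ.* (l ℤ.* l) ∣  ≤⟨ ℕ.m≤n+m _ _ ⟩
    _                      ≡⟨ shear-split N l ⟨
    ∣ shear N l ∣          ∎
    where open ℕ.≤-Reasoning

  ∣N∣≤1+∣shear∣ : ∀ N l → ∣ N ∣ ≤ suc ∣ shear N l ∣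
  ∣N∣≤1+∣shear∣ N l = begin
    ∣ N ∣
      ≡⟨ ≡.cong ∣_∣ (solve 2 (λ N l → N := (N :- l) :+ l) refl N (+ 2 ℤ.* l)) ⟩
    ∣ N ℤ.- + 2 ℤ.* l ℤ.+ + 2 ℤ.* l ∣
      ≤⟨ ℤ.∣i+j∣≤∣i∣+∣j∣ (N ℤ.- + 2 ℤ.* l) (+ 2 ℤ.* l) ⟩
    ∣ N ℤ.- + 2 ℤ.* l ∣ ℕ.+ ∣ + 2 ℤ.* l ∣
      ≤⟨ ℕ.+-mono-≤ (∣j∣≤1+∣j*[j-1]∣ (N ℤ.- + 2 ℤ.* l)) (square-part l) ⟩
    suc (∣ (N ℤ.- + 2 ℤ.* l) ℤ.* ℤ.pred (N ℤ.- + 2 ℤ.* l) ∣ ℕ.+ ∣ + 2 ℤ.* (l ℤ.* l) ∣)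
      ≡⟨ ≡.cong suc (shear-split N l) ⟨
    suc ∣ shear N l ∣ ∎
    where open ℕ.≤-Reasoning

module Quintuple {c ℓ} (T : TruncatedAlgebra c ℓ) where
  open Ring T
  open ThetaProducts T
  open Shear
  open SetoidReasoning setoid
  open ℤ.+-*-Solver using () renaming
    (solve to solveℤ; _:=_ to _⊜_; _:+_ to _⊕_; _:*_ to _⊗_; :-_ to ⊝_; con to κ)
  open Pentagonal 1 using () renaming (pentagonal to pentagonal₂; pentagonal⇓ to pentagonal₂⇓)

  K : ℕ
  K = suc order

  -- The term m = N - 2l of `cube` times the term l of `square`, except that the weight m is
  -- replaced by N. The signs of N and m agree.
  term : ℤ → ℤ → Carrier
  term N l = monomial (N ℤ.* sgn N ℤ.* sgn l) (shear N l)

  term-boxed : Boxed K (λ l N → term N l)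
  term-boxed l N (inj₁ p) = monomial-≥ _ (ℕ.≤-trans (ℕ.<⇒≤ p) (∣l∣≤∣shear∣ N l))
  term-boxed l N (inj₂ p) = monomial-≥ _ (ℕ.≤-pred (ℕ.≤-trans p (∣N∣≤1+∣shear∣ N l)))

  unweighted : ℤ → Carrier
  unweighted m = monomial (sgn m) (m ℤ.* ℤ.pred m)

  -- The involution m ↦ 1 - m fixes m(m - 1) and reverses the sign; a shift by one turns it into j ↦
  -- -1 - j.
  unweighted⇓ : unweighted ⇓ 0#
  unweighted⇓ = ⇓-congˡ (λ j → reflexive (≡.cong unweighted (ℤ.suc-pred j)))
    (⇓-pred (⇓-antisymmetric supported antisymmetric))
    where
    supported : Supported (suc K) (unweighted ∘ ℤ.suc)
    supported j p = monomial-supported {sgn} {λ j → j ℤ.* ℤ.pred j} ∣j∣≤1+∣j*[j-1]∣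
      (ℤ.suc j) (ℕ.≤-pred (ℕ.≤-trans p (∣j∣≤1+∣1+j∣ j)))
      where
      ∣j∣≤1+∣1+j∣ : ∀ j → ∣ j ∣ ≤ suc ∣ ℤ.suc j ∣
      ∣j∣≤1+∣1+j∣ (+ n)        = ℕ.≤-trans (ℕ.n≤1+n n) (ℕ.n≤1+n (suc n))
      ∣j∣≤1+∣1+j∣ -[1+ zero ]  = ℕ.≤-refl
      ∣j∣≤1+∣1+j∣ -[1+ suc n ] = ℕ.≤-refl
    antisymmetric : ∀ j → unweighted (ℤ.suc (-1ℤ ℤ.- j)) ≈ - unweighted (ℤ.suc j)
    antisymmetric j = trans
      (monomial-cong
        (≡.trans (≡.cong sgn (solveℤ 1 (λ j → κ 1ℤ ⊕ (κ -1ℤ ⊕ ⊝ j) ⊜ ⊝ j) refl j))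
          (≡.trans (sgn-neg j) (≡.trans (≡.sym (ℤ.neg-involutive _)) (≡.cong ℤ.-_ (≡.sym (sgn-suc j))))))
        (solveℤ 1 (λ j → let i = κ 1ℤ ⊕ (κ -1ℤ ⊕ ⊝ j) in
          i ⊗ (κ -1ℤ ⊕ i) ⊜ (κ 1ℤ ⊕ j) ⊗ (κ -1ℤ ⊕ (κ 1ℤ ⊕ j))) refl j))
      (monomial-neg _ _)

  -- Since the unweighted sum vanishes, the weight m may be replaced by m + 2l.
  column : ∀ l → (λ N → term N l) ⇓ - (φ∞2 * φ∞2 * φ∞2) * square l
  column l = ⇓-congˡ
    (λ N → reflexive (≡.cong (λ i → term i l)
      (solveℤ 2 (λ l N → κ (+ 2) ⊗ l ⊕ (κ (ℤ.- + 2) ⊗ l ⊕ N) ⊜ N) refl l N)))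
    (⇓-shift (ℤ.- + 2 ℤ.* l) {λ m → term (+ 2 ℤ.* l ℤ.+ m) l} sheared)
    where
    sgn-2l+m : ∀ m → sgn (+ 2 ℤ.* l ℤ.+ m) ≡ sgn m
    sgn-2l+m m = ≡.trans (sgn-+ (+ 2 ℤ.* l) m) (≡.trans (≡.cong (ℤ._* sgn m) sgn-2l) (ℤ.*-identityˡ (sgn m)))
      where
      sgn-2l : sgn (+ 2 ℤ.* l) ≡ 1ℤ
      sgn-2l = ≡.trans (≡.cong sgn (solveℤ 1 (λ l → κ (+ 2) ⊗ l ⊜ l ⊕ l) refl l))
        (≡.trans (sgn-+ l l) (sgn-² l))
    split : ∀ m → square l * cube m + ⟦ + 2 ℤ.* l ⟧ * square l * unweighted m ≈ term (+ 2 ℤ.* l ℤ.+ m) l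
    split m = begin
      square l * cube m + ⟦ + 2 ℤ.* l ⟧ * square l * unweighted m
        ≈⟨ +-cong (monomial-* _ _ (0≤n*i 2 (0≤j*j l)) (0≤j*[j-1] m))
             (trans (*-congʳ (monomial-scale _ _ _)) (monomial-* _ _ (0≤n*i 2 (0≤j*j l)) (0≤j*[j-1] m))) ⟩
      monomial (sgn l ℤ.* (m ℤ.* sgn m)) e + monomial (+ 2 ℤ.* l ℤ.* sgn l ℤ.* sgn m) e
        ≈⟨ monomial-+ _ _ _ ⟨
      monomial (sgn l ℤ.* (m ℤ.* sgn m) ℤ.+ + 2 ℤ.* l ℤ.* sgn l ℤ.* sgn m) e
        ≈⟨ monomial-cong
             (≡.trans (solveℤ 4 (λ l m a b → a ⊗ (m ⊗ b) ⊕ κ (+ 2) ⊗ l ⊗ a ⊗ b ⊜ (κ (+ 2) ⊗ l ⊕ m) ⊗ b ⊗ a)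
                         refl l m (sgn l) (sgn m))
               (≡.cong (λ i → (+ 2 ℤ.* l ℤ.+ m) ℤ.* i ℤ.* sgn l) (≡.sym (sgn-2l+m m))))
             (≡.trans (ℤ.+-comm (+ 2 ℤ.* (l ℤ.* l)) (m ℤ.* ℤ.pred m)) (≡.sym (shear-column l m))) ⟩
      term (+ 2 ℤ.* l ℤ.+ m) l ∎
      where e = + 2 ℤ.* (l ℤ.* l) ℤ.+ m ℤ.* ℤ.pred m
    sheared : (λ m → term (+ 2 ℤ.* l ℤ.+ m) l) ⇓ - (φ∞2 * φ∞2 * φ∞2) * square l
    sheared = ⇓-cong split
      (trans (+-cong (*-comm _ _) (zeroʳ _)) (+-identityʳ _))
      (⇓-+ (⇓-*ˡ (square l) cube⇓) (⇓-*ˡ (⟦ + 2 ℤ.* l ⟧ * square l) unweighted⇓))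

  row : ℤ → Carrier
  row N = bsum K K (term N)

  row⇓ : ∀ N → term N ⇓ row N
  row⇓ N = supported⇒⇓ (λ l p → term-boxed l N (inj₁ p))

  -- Summed over N first, the double series factors into the two theta series; exchanging the order
  -- gives the sum of the rows.
  row-sum : row ⇓ - (φ∞2 * φ∞2 * φ∞2) * γ
  row-sum = ⇓-fubini term-boxed column (⇓-*ˡ _ square⇓) row⇓

  ⇓-unshift : ∀ i {f u} → (λ l → f (i ℤ.+ l)) ⇓ u → f ⇓ u
  ⇓-unshift i {f} p = ⇓-congˡ
    (λ l → reflexive (≡.cong f (solveℤ 2 (λ i l → i ⊕ (⊝ i ⊕ l) ⊜ l) refl i l)))
    (⇓-shift (ℤ.- i) p)

  left right quintuple : ℤ → Carrier
  left      j = monomial (j ℤ.* + 3) (j ℤ.* (+ 3 ℤ.* j ℤ.- 1ℤ))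
  right     j = monomial (ℤ.- (1ℤ ℤ.+ j ℤ.* + 3)) (j ℤ.* (+ 3 ℤ.* j ℤ.+ 1ℤ))
  quintuple j = monomial (1ℤ ℤ.+ + 6 ℤ.* j) (j ℤ.* (+ 3 ℤ.* j ℤ.+ 1ℤ))

  private
    sgn-3j : ∀ j → sgn (j ℤ.* + 3) ≡ sgn j
    sgn-3j j = ≡.trans (≡.cong sgn (solveℤ 1 (λ j → j ⊗ κ (+ 3) ⊜ j ⊕ (j ⊕ j)) refl j))
      (≡.trans (sgn-+ j (j ℤ.+ j)) (≡.trans (≡.cong (sgn j ℤ.*_) (≡.trans (sgn-+ j j) (sgn-² j)))
        (ℤ.*-identityʳ (sgn j))))

    sgn-cancel : ∀ j l → sgn j ℤ.* sgn (j ℤ.+ l) ≡ sgn l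
    sgn-cancel j l = ≡.trans (≡.cong (sgn j ℤ.*_) (sgn-+ j l))
      (≡.trans (≡.sym (ℤ.*-assoc (sgn j) (sgn j) (sgn l)))
        (≡.trans (≡.cong (ℤ._* sgn l) (sgn-² j)) (ℤ.*-identityˡ (sgn l))))

  -- The sign of N = 3j cancels the sign produced by moving l by j; this is why ρ has no alternating
  -- signs.
  row₀ : ∀ j → row (j ℤ.* + 3) ≈ φ∞4 * left j
  row₀ j = ⇓-unique (row⇓ (j ℤ.* + 3)) (⇓-unshift j (⇓-cong summand (*-comm _ _)
    (⇓-*ˡ (left j) (⇓-neg pentagonal₂⇓))))
    where
    summand : ∀ l → left j * pentagonal₂ (ℤ.- l) ≈ term (j ℤ.* + 3) (j ℤ.+ l)
    summand l = trans (monomial-* _ _ (0≤j*[3j-1] j) (0≤n*i 2 (0≤j*[3j-1] (ℤ.- l))))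
      (monomial-cong
        (≡.trans (≡.cong (j ℤ.* + 3 ℤ.*_) (≡.trans (sgn-neg l) (≡.trans (≡.sym (sgn-cancel j l))
          (≡.cong (ℤ._* sgn (j ℤ.+ l)) (≡.sym (sgn-3j j))))))
          (≡.sym (ℤ.*-assoc (j ℤ.* + 3) (sgn (j ℤ.* + 3)) (sgn (j ℤ.+ l)))))
        (≡.sym (shear₀ j l)))

  row₁ : ∀ j → row (1ℤ ℤ.+ j ℤ.* + 3) ≈ φ∞4 * right j
  row₁ j = ⇓-unique (row⇓ N) (⇓-unshift j (⇓-cong summand (*-comm _ _)
    (⇓-*ˡ (right j) pentagonal₂⇓)))
    where
    N = 1ℤ ℤ.+ j ℤ.* + 3
    summand : ∀ l → right j * pentagonal₂ l ≈ term N (j ℤ.+ l)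
    summand l = trans (monomial-* _ _ (0≤j*[3j+1] j) (0≤n*i 2 (0≤j*[3j-1] l)))
      (monomial-cong
        (≡.trans (≡.cong (ℤ.- N ℤ.*_) (≡.sym (sgn-cancel j l)))
          (≡.trans (solveℤ 3 (λ N a b → ⊝ N ⊗ (a ⊗ b) ⊜ N ⊗ ⊝ a ⊗ b) refl N (sgn j) (sgn (j ℤ.+ l)))
            (≡.cong (λ i → N ℤ.* i ℤ.* sgn (j ℤ.+ l))
              (≡.sym (≡.trans (sgn-suc (j ℤ.* + 3)) (≡.cong ℤ.-_ (sgn-3j j)))))))
        (≡.sym (shear₁ j l)))

  row₂ : ∀ j → row (+ 2 ℤ.+ j ℤ.* + 3) ≈ 0#
  row₂ j = ⇓-unique (row⇓ N) (⇓-unshift j {term N} (⇓-congˡ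
    (λ l → reflexive (≡.cong (λ i → term N (j ℤ.+ i)) (ℤ.suc-pred l)))
    (⇓-pred {λ l → term N (j ℤ.+ ℤ.suc l)} (⇓-antisymmetric supported antisymmetric))))
    where
    N = + 2 ℤ.+ j ℤ.* + 3
    supported : Supported (∣ j ∣ ℕ.+ suc K) (λ l → term N (j ℤ.+ ℤ.suc l))
    supported l p = term-boxed (j ℤ.+ ℤ.suc l) N (inj₁ (ℕ.+-cancelˡ-≤ (suc ∣ j ∣) _ _ (ℕ.≤-trans
      (ℕ.≤-reflexive (≡.sym (ℕ.+-suc ∣ j ∣ K))) (ℕ.≤-trans p bound))))
      where
      bound : ∣ l ∣ ≤ suc ∣ j ∣ ℕ.+ ∣ j ℤ.+ ℤ.suc l ∣
      bound = ℕ.≤-trans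
        (ℕ.≤-reflexive (≡.cong ∣_∣ (solveℤ 2 (λ j l → l ⊜ κ -1ℤ ⊕ ⊝ j ⊕ (j ⊕ (κ 1ℤ ⊕ l))) refl j l)))
        (ℕ.≤-trans (ℤ.∣i+j∣≤∣i∣+∣j∣ (-1ℤ ℤ.+ ℤ.- j) (j ℤ.+ ℤ.suc l))
          (ℕ.+-monoˡ-≤ ∣ j ℤ.+ ℤ.suc l ∣ (ℕ.≤-trans (ℤ.∣i+j∣≤∣i∣+∣j∣ -1ℤ (ℤ.- j))
            (ℕ.≤-reflexive (≡.cong suc (ℤ.∣-i∣≡∣i∣ j))))))
    antisymmetric : ∀ l → term N (j ℤ.+ ℤ.suc (-1ℤ ℤ.- l)) ≈ - term N (j ℤ.+ ℤ.suc l)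
    antisymmetric l = trans
      (monomial-cong
        (≡.trans (≡.cong (N ℤ.* sgn N ℤ.*_) sign) (≡.sym (ℤ.neg-distribʳ-* (N ℤ.* sgn N) _)))
        (shear₂ j l))
      (monomial-neg _ _)
      where
      sign : sgn (j ℤ.+ ℤ.suc (-1ℤ ℤ.- l)) ≡ ℤ.- sgn (j ℤ.+ ℤ.suc l)
      sign = ≡.trans (sgn-+ j (ℤ.suc (-1ℤ ℤ.- l)))
        (≡.trans (≡.cong (sgn j ℤ.*_)
          (≡.trans (≡.cong sgn (solveℤ 1 (λ l → κ 1ℤ ⊕ (κ -1ℤ ⊕ ⊝ l) ⊜ ⊝ l) refl l)) (sgn-neg l)))
        (≡.trans (solveℤ 2 (λ a b → a ⊗ b ⊜ ⊝ (a ⊗ ⊝ b)) refl (sgn j) (sgn l))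
          (≡.cong ℤ.-_ (≡.trans (≡.cong (sgn j ℤ.*_) (≡.sym (sgn-suc l))) (≡.sym (sgn-+ j (ℤ.suc l)))))))

  private
    left-supported : Supported K left
    left-supported = monomial-supported ∣j∣≤1+∣j*[3j-1]∣

    right-supported : Supported K right
    right-supported = monomial-supported ∣j∣≤1+∣j*[3j+1]∣

    -- Reflection gives `left` the exponent of `right`; up to sign, the weights 3j and 3j + 1 then
    -- add to 6j + 1.
    reflect-left : ∀ j → quintuple j ≈ - (left (ℤ.- j) + right j)
    reflect-left j = begin
      quintuple j
        ≈⟨ monomial-cong
             (solveℤ 1 (λ j → κ 1ℤ ⊕ κ (+ 6) ⊗ j ⊜
               ⊝ (⊝ j ⊗ κ (+ 3) ⊕ ⊝ (κ 1ℤ ⊕ j ⊗ κ (+ 3)))) refl j) refl ⟩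
      monomial (ℤ.- (ℤ.- j ℤ.* + 3 ℤ.+ ℤ.- (1ℤ ℤ.+ j ℤ.* + 3))) e
        ≈⟨ trans (monomial-neg _ e) (-‿cong (monomial-+ _ _ e)) ⟩
      - (monomial (ℤ.- j ℤ.* + 3) e + right j)
        ≈⟨ -‿cong (+-congʳ (monomial-cong refl
             (solveℤ 1 (λ j → j ⊗ (κ (+ 3) ⊗ j ⊕ κ 1ℤ) ⊜ ⊝ j ⊗ (κ (+ 3) ⊗ ⊝ j ⊕ ⊝ κ 1ℤ)) refl j))) ⟩
      - (left (ℤ.- j) + right j) ∎
      where e = j ℤ.* (+ 3 ℤ.* j ℤ.+ 1ℤ)

  quintuple-supported : Supported K quintuple
  quintuple-supported = monomial-supported ∣j∣≤1+∣j*[3j+1]∣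

  ρ : Carrier
  ρ = bsum K K quintuple

  φ∞4*ρ : φ∞4 * ρ ≈ φ∞2 * φ∞2 * φ∞2 * γ
  φ∞4*ρ = begin
    φ∞4 * ρ
      ≈⟨ *-congˡ (⇓-unique (supported⇒⇓ quintuple-supported)
           (⇓-cong (λ j → sym (reflect-left j)) ≈-refl -sum)) ⟩
    φ∞4 * - (u + v)
      ≈⟨ solve 3 (λ f u v → f :* :- (u :+ v) := :- (f :* u :+ f :* v)) ≈-refl φ∞4 u v ⟩
    - (φ∞4 * u + φ∞4 * v)
      ≈⟨ -‿cong total ⟩
    - (- (φ∞2 * φ∞2 * φ∞2) * γ)
      ≈⟨ solve 2 (λ f g → :- (:- f :* g) := f :* g) ≈-refl _ _ ⟩
    φ∞2 * φ∞2 * φ∞2 * γ ∎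
    where
    u v : Carrier
    u = bsum K K left
    v = bsum K K right
    negate : ∀ {f w} → f ⇓ w → (λ j → - f j) ⇓ - w
    negate p = ⇓-cong -1* (-1*′) (⇓-*ˡ (- 1#) p)
      where
      -1*′ : ∀ {x} → - 1# * x ≈ - x
      -1*′ {x} = trans (solve 2 (λ a b → :- a :* b := :- (a :* b)) ≈-refl 1# x) (-‿cong (*-identityˡ x))
      -1* : ∀ j → _ ≈ _
      -1* j = -1*′
    -sum : (λ j → - (left (ℤ.- j) + right j)) ⇓ - (u + v)
    -sum = negate (⇓-+ (⇓-neg (supported⇒⇓ left-supported)) (supported⇒⇓ right-supported))
    total : φ∞4 * u + φ∞4 * v ≈ - (φ∞2 * φ∞2 * φ∞2) * γ
    total = ⇓-unique
      (⇓-+ (⇓-*ˡ φ∞4 (supported⇒⇓ left-supported)) (⇓-*ˡ φ∞4 (supported⇒⇓ right-supported)))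
      (⇓-congˡ (λ j → trans (+-cong (+-cong (row₀ j) (row₁ j)) (row₂ j)) (+-identityʳ _))
        (⇓-thirds row-sum))

-- The congruence modulo 64 and the exponents that can occur

module Congruence {c ℓ} (T : TruncatedAlgebra c ℓ) where
  open Ring T
  open ThetaProducts T
  open Quintuple T
  open SetoidReasoning setoid
  open Pentagonal 0 using () renaming (pentagonal to pentagonal₁; pentagonal⇓ to pentagonal₁⇓)

  γ-odd : ∃ λ u → γ ≈ 1# + (u + u)
  γ-odd = proj₁ even , trans (⇓-unique square⇓ (proj₂ even)) (+-congʳ square-0)
    where
    even : ∃ λ u → square ⇓ square 0ℤ + (u + u)
    even = ⇓-even {K}
      (λ j p → monomial-≥ _ (ℕ.≤-trans (ℕ.<⇒≤ p) (square-bound j)))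
      (λ j → monomial-cong (sgn-neg j) (≡.cong (+ 2 ℤ.*_)
        (S.solve 1 (λ j → S.:- j S.:* S.:- j S.:= j S.:* j) refl j)))
      where
      module S = ℤ.+-*-Solver
      square-bound : ∀ j → ∣ j ∣ ≤ ∣ + 2 ℤ.* (j ℤ.* j) ∣
      square-bound j = ℕ.≤-trans (n≤n*n ∣ j ∣) (ℕ.≤-trans (ℕ.m≤n*m _ 2) (ℕ.≤-reflexive (≡.sym
        (≡.trans (ℤ.abs-* (+ 2) (j ℤ.* j)) (≡.cong (2 ℕ.*_) (ℤ.abs-* j j))))))
    square-0 : square 0ℤ ≈ 1#
    square-0 = trans (sym (monomial-def _ _)) (trans (*-cong 1-homo pow-0) (*-identityˡ 1#))

  ρ≈φ∞2*γ² : ρ ≈ φ∞2 * (γ * γ)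
  ρ≈φ∞2*γ² = unit-cancel (φ-unit 4 order) (begin
    φ∞4 * ρ                         ≈⟨ φ∞4*ρ ⟩
    φ∞2 * φ∞2 * φ∞2 * γ             ≈⟨ solve 2 (λ f g → f :* f :* f :* g := f :* f :* (f :* g)) ≈-refl _ _ ⟩
    φ∞2 * φ∞2 * (φ∞2 * γ)           ≈⟨ *-congʳ φ∞4*γ ⟨
    φ∞4 * γ * (φ∞2 * γ)             ≈⟨ solve 3 (λ F f g → F :* g :* (f :* g) := F :* (f :* (g :* g))) ≈-refl _ _ _ ⟩
    φ∞4 * (φ∞2 * (γ * γ))           ∎)

  -- Write E for the quotient and γ = 1 + 2u, so that γ² = 1 + 4(u + u²).  The three products
  -- are Eγ², Eγ⁴ and Eγ⁶, and E(1 - γ²)³ = -64 E(u + u²)³.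
  mod-64 : ∀ E → φ∞2 * φ∞2 * E ≈ φ∞4 * φ∞4 → ∃ λ y →
           E ≈ ⟦ + 3 ⟧ * (φ∞2 * φ∞2) + ⟦ ℤ.- + 3 ⟧ * (φ∞2 * ρ) + ρ * ρ + ⟦ + 64 ⟧ * y
  mod-64 E quotient = - (E * (h * h * h)) , (begin
    E
      ≈⟨ solve 2 (λ E u → let g = con 1ℤ :+ (u :+ u) ; h = u :+ u :* u in
           E := con (+ 3) :* (E :* (g :* g)) :+ con (ℤ.- + 3) :* (E :* (g :* g :* (g :* g)))
             :+ E :* (g :* g :* (g :* g) :* (g :* g)) :+ con (+ 64) :* (:- (E :* (h :* h :* h))))
           ≈-refl E u ⟩
    ⟦ + 3 ⟧ * (E * (g * g)) + ⟦ ℤ.- + 3 ⟧ * (E * (g * g * (g * g)))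
      + E * (g * g * (g * g) * (g * g)) + ⟦ + 64 ⟧ * - (E * (h * h * h))
      ≈⟨ +-congʳ (+-cong (+-cong (*-congˡ (sym f²)) (*-congˡ (sym fρ))) (sym ρ²)) ⟩
    ⟦ + 3 ⟧ * (φ∞2 * φ∞2) + ⟦ ℤ.- + 3 ⟧ * (φ∞2 * ρ) + ρ * ρ + ⟦ + 64 ⟧ * - (E * (h * h * h)) ∎)
    where
    u g h : Carrier
    u = proj₁ γ-odd
    g = ⟦ 1ℤ ⟧ + (u + u)
    h = u + u * u
    γ≈g : γ ≈ g
    γ≈g = trans (proj₂ γ-odd) (+-congʳ (sym 1-homo))
    γE≈φ∞4 : γ * E ≈ φ∞4
    γE≈φ∞4 = unit-cancel (φ-unit 4 order)
      (trans (sym (*-assoc _ _ _)) (trans (*-congʳ φ∞4*γ) quotient))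
    f² : φ∞2 * φ∞2 ≈ E * (g * g)
    f² = begin
      φ∞2 * φ∞2          ≈⟨ φ∞4*γ ⟨
      φ∞4 * γ            ≈⟨ *-congʳ γE≈φ∞4 ⟨
      γ * E * γ          ≈⟨ solve 2 (λ E g → g :* E :* g := E :* (g :* g)) ≈-refl E γ ⟩
      E * (γ * γ)        ≈⟨ *-congˡ (*-cong γ≈g γ≈g) ⟩
      E * (g * g)        ∎
    ρ≈ : ρ ≈ φ∞2 * (g * g)
    ρ≈ = trans ρ≈φ∞2*γ² (*-congˡ (*-cong γ≈g γ≈g))
    fρ : φ∞2 * ρ ≈ E * (g * g * (g * g))
    fρ = begin
      φ∞2 * ρ                 ≈⟨ *-congˡ ρ≈ ⟩
      φ∞2 * (φ∞2 * (g * g))   ≈⟨ *-assoc _ _ _ ⟨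
      φ∞2 * φ∞2 * (g * g)     ≈⟨ *-congʳ f² ⟩
      E * (g * g) * (g * g)   ≈⟨ *-assoc _ _ _ ⟩
      E * (g * g * (g * g))   ∎
    ρ² : ρ * ρ ≈ E * (g * g * (g * g) * (g * g))
    ρ² = begin
      ρ * ρ                                ≈⟨ *-congʳ ρ≈ ⟩
      φ∞2 * (g * g) * ρ                    ≈⟨ solve 3 (λ f g r → f :* g :* r := f :* r :* g) ≈-refl _ _ _ ⟩
      φ∞2 * ρ * (g * g)                    ≈⟨ *-congʳ fρ ⟩
      E * (g * g * (g * g)) * (g * g)      ≈⟨ *-assoc _ _ _ ⟩
      E * (g * g * (g * g) * (g * g))      ∎

  φ∞2-sum : φ∞2 ≈ bsum K K pentagonal₁
  φ∞2-sum = ⇓-unique pentagonal₁⇓ (supported⇒⇓ (monomial-supported λ j →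
    ≡.subst (λ i → ∣ j ∣ ≤ suc ∣ i ∣) (≡.sym (ℤ.*-identityˡ (j ℤ.* (+ 3 ℤ.* j ℤ.- 1ℤ)))) (∣j∣≤1+∣j*[3j-1]∣ j)))

  -- Applied to P x = ‘a fixed coefficient of x is zero’.
  module Vanishing {p} (P : Carrier → Set p) (P-resp : ∀ {x y} → x ≈ y → P x → P y)
                   (P-0 : P 0#) (P-+ : ∀ {x y} → P x → P y → P (x + y)) where

    P-bsum : ∀ a b {f} → (∀ j → P (f j)) → P (bsum a b f)
    P-bsum a b {f} P-f = P-resp (sym (bsum-def a b f))
      (P-+ (P-sum a (λ i → P-f -[1+ i ])) (P-sum b (λ i → P-f (+ i))))
      where
      P-sum : ∀ n {g} → (∀ i → P (g i)) → P (sum< n g)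
      P-sum zero    P-g = P-0
      P-sum (suc n) P-g = P-+ (P-sum n P-g) (P-g n)

    P-product : ∀ {f g} → (∀ i j → P (f i * g j)) → P (bsum K K f * bsum K K g)
    P-product {f} {g} P-fg = P-resp (bsum-*ˡ K K (bsum K K f) g) (P-bsum K K λ j →
      P-resp (trans (bsum-*ˡ K K (g j) f) (*-comm (g j) _)) (P-bsum K K λ i →
        P-resp (*-comm (f i) (g j)) (P-fg i j)))

    -- Completing the square: 12 j(3j ∓ 1) + 1 = (6j ∓ 1)², so a sum e of two such exponents has 12e
    -- + 2 = x² + y².
    P-products : (∀ w x y {e} → 0ℤ ℤ.≤ e → + 12 ℤ.* e ℤ.+ + 2 ≡ x ℤ.* x ℤ.+ y ℤ.* y →
                  P (monomial w e)) →
                 P (φ∞2 * φ∞2) × P (φ∞2 * ρ) × P (ρ * ρ)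
    P-products P-monomial =
        P-resp (sym (*-cong φ∞2-sum φ∞2-sum)) (P-product λ i j → P-resp
          (sym (monomial-* _ _ (0≤n*i 1 (0≤j*[3j-1] i)) (0≤n*i 1 (0≤j*[3j-1] j))))
          (P-monomial _ (+ 6 ℤ.* i ℤ.- 1ℤ) (+ 6 ℤ.* j ℤ.- 1ℤ) 
            (ℤ.+-mono-≤ (0≤n*i 1 (0≤j*[3j-1] i)) (0≤n*i 1 (0≤j*[3j-1] j)))
            (solveℤ 2 (λ i j →
              let x = κ (+ 6) ⊗ i ⊕ κ -1ℤ
                  y = κ (+ 6) ⊗ j ⊕ κ -1ℤ in
              κ (+ 12) ⊗ (κ 1ℤ ⊗ (i ⊗ (κ (+ 3) ⊗ i ⊕ κ -1ℤ)) ⊕ κ 1ℤ ⊗ (j ⊗ (κ (+ 3) ⊗ j ⊕ κ -1ℤ))) ⊕ κ (+ 2)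
                ⊜ x ⊗ x ⊕ y ⊗ y) refl i j)))
      , P-resp (sym (*-congʳ φ∞2-sum)) (P-product λ i j → P-resp
          (sym (monomial-* _ _ (0≤n*i 1 (0≤j*[3j-1] i)) (0≤j*[3j+1] j)))
          (P-monomial _ (+ 6 ℤ.* i ℤ.- 1ℤ) (+ 6 ℤ.* j ℤ.+ 1ℤ) 
            (ℤ.+-mono-≤ (0≤n*i 1 (0≤j*[3j-1] i)) (0≤j*[3j+1] j))
            (solveℤ 2 (λ i j →
              let x = κ (+ 6) ⊗ i ⊕ κ -1ℤ
                  y = κ (+ 6) ⊗ j ⊕ κ 1ℤ in
              κ (+ 12) ⊗ (κ 1ℤ ⊗ (i ⊗ (κ (+ 3) ⊗ i ⊕ κ -1ℤ)) ⊕ j ⊗ (κ (+ 3) ⊗ j ⊕ κ 1ℤ)) ⊕ κ (+ 2)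
                ⊜ x ⊗ x ⊕ y ⊗ y) refl i j)))
      , P-product λ i j → P-resp
          (sym (monomial-* _ _ (0≤j*[3j+1] i) (0≤j*[3j+1] j)))
          (P-monomial _ (+ 6 ℤ.* i ℤ.+ 1ℤ) (+ 6 ℤ.* j ℤ.+ 1ℤ) 
            (ℤ.+-mono-≤ (0≤j*[3j+1] i) (0≤j*[3j+1] j))
            (solveℤ 2 (λ i j →
              let x = κ (+ 6) ⊗ i ⊕ κ 1ℤ
                  y = κ (+ 6) ⊗ j ⊕ κ 1ℤ in
              κ (+ 12) ⊗ (i ⊗ (κ (+ 3) ⊗ i ⊕ κ 1ℤ) ⊕ j ⊗ (κ (+ 3) ⊗ j ⊕ κ 1ℤ)) ⊕ κ (+ 2)
                ⊜ x ⊗ x ⊕ y ⊗ y) refl i j))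
      where
      open ℤ.+-*-Solver using () renaming
        (solve to solveℤ; _:=_ to _⊜_; _:+_ to _⊕_; _:*_ to _⊗_; con to κ)

-- Sums of two squares modulo 7 and 49

residues : List ℕ
residues = 22 ∷ 36 ∷ 50 ∷ 64 ∷ 78 ∷ 92 ∷ []

-- 7 divides 12r + 2 exactly when r ≡ 1 modulo 7. The even such r below 98 are these six and 8, and
-- 8 is ruled out by 12 · 8 + 2 = 2 · 49.
residue-mod-49 : ∀ {r} → r ∈ residues → 7 ℕ.∣ 12 ℕ.* r ℕ.+ 2 × ¬ 49 ℕ.∣ 12 ℕ.* r ℕ.+ 2
residue-mod-49 = All.lookup (from-yes (All.all?
  (λ r → (7 ℕ.∣? 12 ℕ.* r ℕ.+ 2) ×-dec ¬? (49 ℕ.∣? 12 ℕ.* r ℕ.+ 2)) residues))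

-- -1 is not a square modulo 7.
7∣x²+y²⇒7∣x : ∀ x y → 7 ℕ.∣ x ℕ.* x ℕ.+ y ℕ.* y → 7 ℕ.∣ x × 7 ℕ.∣ y
7∣x²+y²⇒7∣x x y d = ℕ.m%n≡0⇒n∣m x 7 (proj₁ zeros) , ℕ.m%n≡0⇒n∣m y 7 (proj₂ zeros)
  where
  reduced : (x ℕ.% 7 ℕ.* (x ℕ.% 7) ℕ.% 7 ℕ.+ y ℕ.% 7 ℕ.* (y ℕ.% 7) ℕ.% 7) ℕ.% 7 ≡ 0
  reduced = ≡.trans (≡.sym (≡.trans (ℕ.%-distribˡ-+ (x ℕ.* x) (y ℕ.* y) 7)
    (≡.cong₂ (λ a b → (a ℕ.+ b) ℕ.% 7) (ℕ.%-distribˡ-* x x 7) (ℕ.%-distribˡ-* y y 7))))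
    (ℕ.n∣m⇒m%n≡0 _ 7 d)
  squares : ∀ (a b : Fin 7) → (toℕ a ℕ.* toℕ a ℕ.% 7 ℕ.+ toℕ b ℕ.* toℕ b ℕ.% 7) ℕ.% 7 ≡ 0 →
            toℕ a ≡ 0 × toℕ b ≡ 0
  squares = from-yes (Fin.all? {n = 7} λ a → Fin.all? {n = 7} λ b →
    ((toℕ a ℕ.* toℕ a ℕ.% 7 ℕ.+ toℕ b ℕ.* toℕ b ℕ.% 7) ℕ.% 7 ℕ.≟ 0) →-dec
    ((toℕ a ℕ.≟ 0) ×-dec (toℕ b ℕ.≟ 0)))
  zeros : x ℕ.% 7 ≡ 0 × y ℕ.% 7 ≡ 0
  zeros = ≡.subst₂ (λ a b → (a ℕ.* a ℕ.% 7 ℕ.+ b ℕ.* b ℕ.% 7) ℕ.% 7 ≡ 0 → a ≡ 0 × b ≡ 0)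
    (Fin.toℕ-fromℕ< (ℕ.m%n<n x 7)) (Fin.toℕ-fromℕ< (ℕ.m%n<n y 7))
    (squares (Fin.fromℕ< (ℕ.m%n<n x 7)) (Fin.fromℕ< (ℕ.m%n<n y 7))) reduced

not-sum-of-squares : ∀ n {r} → r ∈ residues → ∀ x y →
  12 ℕ.* (98 ℕ.* n ℕ.+ r) ℕ.+ 2 ≢ x ℕ.* x ℕ.+ y ℕ.* y
not-sum-of-squares n {r} r∈ x y e = proj₂ (residue-mod-49 r∈)
  (ℕ.∣m+n∣m⇒∣n (≡.subst (49 ℕ.∣_) (≡.trans (≡.sym e) split) 49∣) (ℕ.divides (24 ℕ.* n) 49-part))
  where
  open ℕ.+-*-Solver
  -- 12 · 98 = 1176 = 24 · 49, so only 12r + 2 matters modulo 7 and 49.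
  split : 12 ℕ.* (98 ℕ.* n ℕ.+ r) ℕ.+ 2 ≡ 1176 ℕ.* n ℕ.+ (12 ℕ.* r ℕ.+ 2)
  split = solve 2 (λ n r → con 12 :* (con 98 :* n :+ r) :+ con 2 :=
    con 1176 :* n :+ (con 12 :* r :+ con 2)) refl n r
  49-part : 1176 ℕ.* n ≡ 24 ℕ.* n ℕ.* 49
  49-part = solve 1 (λ n → con 1176 :* n := con 24 :* n :* con 49) refl n
  7-part : 1176 ℕ.* n ≡ 168 ℕ.* n ℕ.* 7
  7-part = solve 1 (λ n → con 1176 :* n := con 168 :* n :* con 7) refl n
  7∣ : 7 ℕ.∣ x × 7 ℕ.∣ y
  7∣ = 7∣x²+y²⇒7∣x x y (≡.subst (7 ℕ.∣_) (≡.trans (≡.sym split) e)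
    (ℕ.∣m∣n⇒∣m+n (ℕ.divides (168 ℕ.* n) 7-part) (proj₁ (residue-mod-49 r∈))))
  49∣ : 49 ℕ.∣ x ℕ.* x ℕ.+ y ℕ.* y
  49∣ = ℕ.∣m∣n⇒∣m+n (ℕ.*-pres-∣ (proj₁ 7∣) (proj₁ 7∣)) (ℕ.*-pres-∣ (proj₂ 7∣) (proj₂ 7∣))

-- Integer power series modulo q^N as a truncated algebra

module ℤΣ = Sums ℤ.+-*-commutativeRing
open ℤΣ using (asum)

-- Pairs k + l = n replace truncated subtraction, which makes the ring laws instances of the
-- antidiagonal lemmas.
⋆-asum : ∀ f g n → (f ⋆ g) n ≡ asum n (λ k l → f k ℤ.* g l)
⋆-asum f g n = sum-asum n (λ k l → f k ℤ.* g l)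
  where
  open import Algebra.Properties.CommutativeMonoid.Sum ℤ.+-0-commutativeMonoid using (sum)
  sum-asum : ∀ n h → sum {suc n} (λ i → h (toℕ i) (n ℕ.∸ toℕ i)) ≡ asum n h
  sum-asum zero    h = ℤ.+-identityʳ (h 0 0)
  sum-asum (suc n) h = ≡.cong (λ i → h 0 (suc n) ℤ.+ i) (sum-asum n (λ k l → h (suc k) l))

⋆-comm : ∀ f g → f ⋆ g ≗ g ⋆ f
⋆-comm f g n = begin
  (f ⋆ g) n                          ≡⟨ ⋆-asum f g n ⟩
  asum n (λ k l → f k ℤ.* g l)       ≡⟨ ℤΣ.asum-flip n _ ⟩
  asum n (λ k l → f l ℤ.* g k)       ≡⟨ ℤΣ.asum-cong n (λ k l _ → ℤ.*-comm (f l) (g k)) ⟩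
  asum n (λ k l → g k ℤ.* f l)       ≡⟨ ⋆-asum g f n ⟨
  (g ⋆ f) n                          ∎
  where open ≡.≡-Reasoning

⋆-assoc : ∀ f g h → (f ⋆ g) ⋆ h ≗ f ⋆ (g ⋆ h)
⋆-assoc f g h n = begin
  ((f ⋆ g) ⋆ h) n
    ≡⟨ ⋆-asum (f ⋆ g) h n ⟩
  asum n (λ k l → (f ⋆ g) k ℤ.* h l)
    ≡⟨ ℤΣ.asum-cong n (λ k l _ → inner k l) ⟩
  asum n (λ k l → asum k (λ i j → f i ℤ.* (g j ℤ.* h l)))
    ≡⟨ ℤΣ.asum-assoc n (λ i j l → f i ℤ.* (g j ℤ.* h l)) ⟩
  asum n (λ i k → asum k (λ j l → f i ℤ.* (g j ℤ.* h l)))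
    ≡⟨ ℤΣ.asum-cong n (λ i k _ → ≡.trans (ℤΣ.asum-*ˡ k (f i) _)
         (≡.cong (f i ℤ.*_) (≡.sym (⋆-asum g h k)))) ⟩
  asum n (λ i k → f i ℤ.* (g ⋆ h) k)
    ≡⟨ ⋆-asum f (g ⋆ h) n ⟨
  (f ⋆ (g ⋆ h)) n ∎
  where
  open ≡.≡-Reasoning
  inner : ∀ k l → (f ⋆ g) k ℤ.* h l ≡ asum k (λ i j → f i ℤ.* (g j ℤ.* h l))
  inner k l = begin
    (f ⋆ g) k ℤ.* h l
      ≡⟨ ≡.trans (≡.cong (ℤ._* h l) (⋆-asum f g k)) (ℤ.*-comm _ (h l)) ⟩
    h l ℤ.* asum k (λ i j → f i ℤ.* g j)
      ≡⟨ ℤΣ.asum-*ˡ k (h l) _ ⟨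
    asum k (λ i j → h l ℤ.* (f i ℤ.* g j))
      ≡⟨ ℤΣ.asum-cong k (λ i j _ → ≡.trans (ℤ.*-comm (h l) _) (ℤ.*-assoc (f i) (g j) (h l))) ⟩
    asum k (λ i j → f i ℤ.* (g j ℤ.* h l)) ∎

⋆-distribˡ : ∀ f g h n → (f ⋆ (λ n → g n ℤ.+ h n)) n ≡ (f ⋆ g) n ℤ.+ (f ⋆ h) n
⋆-distribˡ f g h n = begin
  (f ⋆ (λ n → g n ℤ.+ h n)) n
    ≡⟨ ⋆-asum f _ n ⟩
  asum n (λ k l → f k ℤ.* (g l ℤ.+ h l))
    ≡⟨ ℤΣ.asum-cong n (λ k l _ → ℤ.*-distribˡ-+ (f k) (g l) (h l)) ⟩
  asum n (λ k l → f k ℤ.* g l ℤ.+ f k ℤ.* h l)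
    ≡⟨ ℤΣ.asum-+ n _ _ ⟩
  asum n (λ k l → f k ℤ.* g l) ℤ.+ asum n (λ k l → f k ℤ.* h l)
    ≡⟨ ≡.cong₂ ℤ._+_ (⋆-asum f g n) (⋆-asum f h n) ⟨
  (f ⋆ g) n ℤ.+ (f ⋆ h) n ∎
  where open ≡.≡-Reasoning

asum-0 : ∀ n → asum n (λ _ _ → 0ℤ) ≡ 0ℤ
asum-0 zero    = refl
asum-0 (suc n) = ≡.trans (ℤ.+-identityˡ _) (asum-0 n)

constant : ℤ → Series
constant z n = z ℤ.* (q^ 0) n

constant-⋆ : ∀ z f n → (constant z ⋆ f) n ≡ z ℤ.* f n
constant-⋆ z f n = ≡.trans (⋆-asum (constant z) f n) (first n)
  where
  first : ∀ n → asum n (λ k l → constant z k ℤ.* f l) ≡ z ℤ.* f n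
  first zero    = ≡.cong (ℤ._* f 0) (ℤ.*-identityʳ z)
  first (suc n) = ≡.trans
    (≡.cong₂ ℤ._+_ (≡.cong (ℤ._* f (suc n)) (ℤ.*-identityʳ z))
      (≡.trans (ℤΣ.asum-cong n (λ k l _ → ≡.trans (≡.cong (ℤ._* f l) (ℤ.*-zeroʳ z)) (ℤ.*-zeroˡ (f l))))
        (asum-0 n)))
    (ℤ.+-identityʳ _)

⋆-identityˡ : ∀ f → q^ 0 ⋆ f ≗ f
⋆-identityˡ f n = ≡.trans (⋆-congʳ n) (≡.trans (constant-⋆ 1ℤ f n) (ℤ.*-identityˡ (f n)))
  where
  ⋆-congʳ : ∀ n → (q^ 0 ⋆ f) n ≡ (constant 1ℤ ⋆ f) n
  ⋆-congʳ n = ≡.trans (⋆-asum (q^ 0) f n) (≡.trans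
    (ℤΣ.asum-cong n λ k l _ → ≡.cong (ℤ._* f l) (≡.sym (ℤ.*-identityˡ ((q^ 0) k))))
    (≡.sym (⋆-asum (constant 1ℤ) f n)))

q^-+ : ∀ m n → q^ (m ℕ.+ n) ≗ q^ m ⋆ q^ n
q^-+ zero    n j       = ≡.sym (⋆-identityˡ (q^ n) j)
q^-+ (suc m) n zero    = refl
q^-+ (suc m) n (suc j) = begin
  (q^ (m ℕ.+ n)) j                                      ≡⟨ q^-+ m n j ⟩
  (q^ m ⋆ q^ n) j                                       ≡⟨ ⋆-asum (q^ m) (q^ n) j ⟩
  asum j (λ k l → (q^ m) k ℤ.* (q^ n) l)                ≡⟨ ℤ.+-identityˡ _ ⟨
  0ℤ ℤ.+ asum j (λ k l → (q^ m) k ℤ.* (q^ n) l)         ≡⟨ ⋆-asum (q^ suc m) (q^ n) (suc j) ⟨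
  (q^ suc m ⋆ q^ n) (suc j)                             ∎
  where open ≡.≡-Reasoning

q^-≢ : ∀ m n → m ≢ n → (q^ m) n ≡ 0ℤ
q^-≢ zero    zero    ne = contradiction refl ne
q^-≢ zero    (suc n) ne = refl
q^-≢ (suc m) zero    ne = refl
q^-≢ (suc m) (suc n) ne = q^-≢ m n (ne ∘ ≡.cong suc)

module Truncated (N : ℕ) where

  infix 4 _≈_
  -- Congruence modulo q^N as setoid equality on full series. It respects `_⋆_` because coefficient
  -- n of a product involves only coefficients up to n.
  _≈_ : Series → Series → Set
  f ≈ g = ∀ n → n < N → f n ≡ g n

  ≈-isEquivalence : IsEquivalence _≈_
  ≈-isEquivalence = record
    { refl  = λ _ _ → refl
    ; sym   = λ e n p → ≡.sym (e n p)
    ; trans = λ e e′ n p → ≡.trans (e n p) (e′ n p)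
    }

  ⋆-cong : ∀ {f f′ g g′} → f ≈ f′ → g ≈ g′ → f ⋆ g ≈ f′ ⋆ g′
  ⋆-cong {f} {f′} {g} {g′} e e′ n p = ≡.trans (⋆-asum f g n) (≡.trans
    (ℤΣ.asum-cong n λ k l k+l≡n → ≡.cong₂ ℤ._*_
      (e k (ℕ.≤-<-trans (ℕ.≤-trans (ℕ.m≤m+n k l) (ℕ.≤-reflexive k+l≡n)) p))
      (e′ l (ℕ.≤-<-trans (ℕ.≤-trans (ℕ.m≤n+m l k) (ℕ.≤-reflexive k+l≡n)) p)))
    (≡.sym (⋆-asum f′ g′ n)))

  seriesRing : CommutativeRing _ _
  seriesRing = record
    { Carrier = Series
    ; _≈_     = _≈_
    ; _+_     = λ f g n → f n ℤ.+ g n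
    ; _*_     = _⋆_
    ; -_      = λ f n → ℤ.- f n
    ; 0#      = λ _ → 0ℤ
    ; 1#      = q^ 0
    ; isCommutativeRing = record
      { isRing = record
        { +-isAbelianGroup = record
          { isGroup = record
            { isMonoid = record
              { isSemigroup = record
                { isMagma = record
                  { isEquivalence = ≈-isEquivalence
                  ; ∙-cong        = λ e e′ n p → ≡.cong₂ ℤ._+_ (e n p) (e′ n p)
                  }
                ; assoc = λ f g h n _ → ℤ.+-assoc (f n) (g n) (h n)
                }
              ; identity = (λ f n _ → ℤ.+-identityˡ (f n)) , (λ f n _ → ℤ.+-identityʳ (f n))
              }
            ; inverse = (λ f n _ → ℤ.+-inverseˡ (f n)) , (λ f n _ → ℤ.+-inverseʳ (f n))
            ; ⁻¹-cong = λ e n p → ≡.cong ℤ.-_ (e n p)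
            }
          ; comm = λ f g n _ → ℤ.+-comm (f n) (g n)
          }
        ; *-cong     = ⋆-cong
        ; *-assoc    = λ f g h n _ → ⋆-assoc f g h n
        ; *-identity = (λ f n _ → ⋆-identityˡ f n)
                     , (λ f n _ → ≡.trans (⋆-comm f (q^ 0) n) (⋆-identityˡ f n))
        ; distrib    = (λ f g h n _ → ⋆-distribˡ f g h n)
                     , (λ f g h n _ → ≡.trans (⋆-comm (λ n → g n ℤ.+ h n) f n)
                         (≡.trans (⋆-distribˡ f g h n) (≡.cong₂ ℤ._+_ (⋆-comm f g n) (⋆-comm f h n))))
        }
      ; *-comm = λ f g n _ → ⋆-comm f g n
      }
    }

  algebra : TruncatedAlgebra _ _
  algebra = record
    { baseRing = seriesRing
    ; const    = record
      { ⟦_⟧    = constant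
      ; +-homo = λ a b n _ → ℤ.*-distribʳ-+ ((q^ 0) n) a b
      ; *-homo = λ a b n _ → ≡.trans (ℤ.*-assoc a b ((q^ 0) n)) (≡.sym (constant-⋆ a (constant b) n))
      ; -‿homo = λ a n _ → ≡.sym (ℤ.neg-distribˡ-* a ((q^ 0) n))
      ; 0-homo = λ n _ → ℤ.*-zeroˡ ((q^ 0) n)
      ; 1-homo = λ n _ → ℤ.*-identityˡ ((q^ 0) n)
      }
    ; pow      = q^_
    ; pow-0    = λ _ _ → refl
    ; pow-+    = λ m n j _ → q^-+ m n j
    ; order    = N
    ; pow-≥    = λ m N≤m n n<N → q^-≢ m n (ℕ.>⇒≢ (ℕ.<-≤-trans n<N N≤m))
    }

  open Ring algebra using (φ; φ∞)

  φ-partialProduct : ∀ k n → φ k n ≡ partialProduct k n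
  φ-partialProduct k zero    = refl
  φ-partialProduct k (suc n) =
    ≡.cong ((λ j → (q^ 0) j ℤ.- (q^ (k ℕ.* suc n)) j) ⋆_) (φ-partialProduct k n)

  φ∞≈f : ∀ k .{{_ : ℕ.NonZero k}} → φ∞ k ≈ f[ k ]
  φ∞≈f k n n<N = ≡.trans (≡.cong (λ f → f n) (φ-partialProduct k N))
                         (partialProduct-stable k (ℕ.<⇒≤ n<N))

  φ∞-EOᵤ : (φ∞ 2 ⋆ φ∞ 2) ⋆ EOᵤ ≈ φ∞ 4 ⋆ φ∞ 4
  φ∞-EOᵤ = begin
    (φ∞ 2 ⋆ φ∞ 2) ⋆ EOᵤ   ≈⟨ ⋆-cong {g = EOᵤ} (⋆-cong (φ∞≈f 2) (φ∞≈f 2)) (λ _ _ → refl) ⟩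
    f[ 2 ] ² ⋆ EOᵤ        ≈⟨ (λ n _ → EOᵤ-spec n) ⟩
    f[ 4 ] ²              ≈⟨ ⋆-cong (φ∞≈f 4) (φ∞≈f 4) ⟨
    φ∞ 4 ⋆ φ∞ 4           ∎
    where open SetoidReasoning (CommutativeRing.setoid seriesRing)

-- Reading off the coefficient of q^n

EOᵤ-mod-64 : ∀ n → (∀ x y → 12 ℕ.* n ℕ.+ 2 ≢ x ℕ.* x ℕ.+ y ℕ.* y) → + 64 ℤ.∣ EOᵤ n
EOᵤ-mod-64 n not-sum = ℤ.divides (y n) (≡.trans expansion (≡.trans
  (≡.cong₂ ℤ._+_ (≡.cong₂ ℤ._+_ (≡.cong₂ ℤ._+_
    (≡.trans (constant-⋆ (+ 3) (φ∞ 2 ⋆ φ∞ 2) n) (≡.cong (+ 3 ℤ.*_) (proj₁ vanish)))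
    (≡.trans (constant-⋆ (ℤ.- + 3) (φ∞ 2 ⋆ ρ) n) (≡.cong (ℤ.- + 3 ℤ.*_) (proj₁ (proj₂ vanish)))))
    (proj₂ (proj₂ vanish)))
    (constant-⋆ (+ 64) y n))
  (≡.trans (ℤ.+-identityˡ _) (ℤ.*-comm (+ 64) (y n)))))
  where
  -- Modulo q^(n+1), the coefficient of q^n is the last one still visible.
  open Truncated (suc n)
  open Ring algebra using (φ∞)
  open ThetaProducts algebra using (monomial; monomial-def)
  open Quintuple algebra using (ρ)
  open Congruence algebra
  witness = mod-64 EOᵤ φ∞-EOᵤ
  y : Series
  y = proj₁ witness
  expansion : EOᵤ n ≡ (constant (+ 3) ⋆ (φ∞ 2 ⋆ φ∞ 2)) n ℤ.+ (constant (ℤ.- + 3) ⋆ (φ∞ 2 ⋆ ρ)) n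
                        ℤ.+ (ρ ⋆ ρ) n ℤ.+ (constant (+ 64) ⋆ y) n
  expansion = proj₂ witness n ℕ.≤-refl
  monomial-vanishes : ∀ w x y {e} → 0ℤ ℤ.≤ e → + 12 ℤ.* e ℤ.+ + 2 ≡ x ℤ.* x ℤ.+ y ℤ.* y →
                      monomial w e n ≡ 0ℤ
  monomial-vanishes w x y {e} 0≤e eq = ≡.trans (≡.sym (monomial-def w e n ℕ.≤-refl))
    (≡.trans (constant-⋆ w (q^ ∣ e ∣) n)
      (≡.trans (≡.cong (w ℤ.*_) (q^-≢ ∣ e ∣ n (distinct 0≤e eq))) (ℤ.*-zeroʳ w)))
    where
    square-abs : ∀ x → x ℤ.* x ≡ + (∣ x ∣ ℕ.* ∣ x ∣)
    square-abs x = ≡.trans (≡.sym (ℤ.0≤i⇒+∣i∣≡i (0≤j*j x))) (≡.cong +_ (ℤ.abs-* x x))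
    distinct : ∀ {e} → 0ℤ ℤ.≤ e → + 12 ℤ.* e ℤ.+ + 2 ≡ x ℤ.* x ℤ.+ y ℤ.* y → ∣ e ∣ ≢ n
    distinct {+ m} _ eq refl = not-sum ∣ x ∣ ∣ y ∣ (ℤ.+-injective (≡.trans
      (≡.cong (ℤ._+ + 2) (ℤ.pos-* 12 m)) (≡.trans eq (≡.cong₂ ℤ._+_ (square-abs x) (square-abs y)))))
  vanish : (φ∞ 2 ⋆ φ∞ 2) n ≡ 0ℤ × (φ∞ 2 ⋆ ρ) n ≡ 0ℤ × (ρ ⋆ ρ) n ≡ 0ℤ
  vanish = Vanishing.P-products (λ f → f n ≡ 0ℤ)
    (λ e f≡0 → ≡.trans (≡.sym (e n ℕ.≤-refl)) f≡0) refl (≡.cong₂ ℤ._+_) monomial-vanishes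

open import Data.Nat.Base using (ℕ; _+_; _*_)
open import Data.Integer.Base using (+_)
open import Data.Integer.Divisibility.Signed using (_∣_)

theorem5p2 : (n r : ℕ) → r ∈ 22 ∷ 36 ∷ 50 ∷ 64 ∷ 78 ∷ 92 ∷ [] →
    + 64 ∣ EOᵤ (98 * n + r)
theorem5p2 n r r∈ = EOᵤ-mod-64 (98 * n + r) (not-sum-of-squares n r∈)
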